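{- Let $b$ be a complex number and let $m\ge1$ be an integer. Then for all integers $n\ge 0$, $$D_{ -m}(b;n)=\det\bigl(M_b(-m+i+j)\bigr)_{i,j=0}^{n-1}=p_{m+1}(-n).$$ Equivalently, $D_{ -m}(b;n)=0$ for $1\le n\le m$, and $D_{ -m}(b;n)=(-1)^{\binom{m+1}{2}}p_{m+1}(n-m-1)$ for $n\ge m+1$.
   Context: For a complex parameter $b$ and $n\ge0$, $M_b(n)=\sum_{k=0}^{n}\Bigl(\binom{n+k}{k}-\binom{n+k}{k-1}\Bigr)b^{n-k}$ (with $\binom{r}{ -1}=0$), extended by $M_b(n)=0$ for $n<0$; equivalently $\sum_{n\ge0}M_b(n)x^n=\frac{C(x)}{1-bxC(x)}$ where $C(x)=\sum_{n\ge0}C_nx^n=\frac{1-\sqrt{1-4x}}{2x}$ is the Catalan generating function. For $m\in\mathbb Z$, $D_m(b;n)=\det(M_b(m+i+j))_{i,j=0}^{n-1}$, the $0\times0$ determinant being $1$. For an integer $m\ge0$, $p_m(n)$ is the polynomial $\prod_{1\le i\le j\le m-1}\frac{2n+i+j}{i+j}$ in $n$ (empty product $=1$). -}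

module Defs where

open import Algebra.Bundles using (CommutativeRing)
open import Data.Fin.Base using (zero; suc; toℕ; punchIn)
open import Data.Integer.Base as ℤ using (ℤ; +_; -[1+_])
open import Data.Nat.Base as ℕ using (ℕ; zero; suc; _∸_)
open import Data.Nat.Combinatorics using (_C_)
open import Data.Rational.Base as ℚ using (ℚ)
open import Data.Vec.Functional using (Vector)
import Algebra.Definitions.RawSemiring as RawSemiringDefinitions

-- p m x = ∏_{1≤i≤j≤m-1} (2x+i+j)/(i+j), with the polynomial variable x
-- ranging over ℚ.  The Fin indices i′, j′ stand for i-1, j-1, so that
-- j′ < m ∸ 1 and i′ < j′ + 1.
p : ℕ → ℚ → ℚ
p m x =
  product {m ∸ 1} λ j′ →
  product {suc (toℕ j′)} λ i′ →
    let i = suc (toℕ i′)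
        j = suc (toℕ j′)
    in ((+ 2 ℚ./ 1) ℚ.* x ℚ.+ (+ (i ℕ.+ j) ℚ./ 1)) ℚ.* (+ 1 ℚ./ (i ℕ.+ j))
  where open RawSemiringDefinitions ℚ.+-*-rawSemiring using (product)

-- r C-pred k is the binomial coefficient "r choose k-1", with "r choose -1" = 0.
_C-pred_ : ℕ → ℕ → ℕ
r C-pred zero  = 0
r C-pred suc k = r C k

-- R is to be read as ℂ, which the library lacks; the parameter b lies in R.
module _ {c ℓ} (R : CommutativeRing c ℓ) where
  open CommutativeRing R hiding (zero)
  open import Algebra.Properties.Semiring.Exp semiring using (_^_)
  open import Algebra.Properties.Semiring.Mult semiring using (_×_)
  open import Algebra.Properties.Semiring.Sum semiring using (sum)

  Matrix : ℕ → Set c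
  Matrix n = Vector (Vector Carrier n) n

  -- Laplace expansion along the first row; the 0×0 determinant is 1.
  det : ∀ {n} → Matrix n → Carrier
  det {zero}  A = 1#
  det {suc n} A = sum λ j →
    ((- 1#) ^ toℕ j * A zero j) * det {n} (λ i k → A (suc i) (punchIn j k))

  M : Carrier → ℤ → Carrier
  M b (+ n)    = sum {suc n} λ k′ →
    let k = toℕ k′
    in (((n ℕ.+ k) C k) × 1# - ((n ℕ.+ k) C-pred k) × 1#) * b ^ (n ∸ k)
  M b -[1+ _ ] = 0#

  D : ℤ → Carrier → ℕ → Carrier
  D m b n = det {n} λ i j → M b (m ℤ.+ + toℕ i ℤ.+ + toℕ j)

{-# OPTIONS --safe #-}
-- Let L be the functional with moments L(y^k) = M_b(k), and more generally let
-- L_t(y^k) = M_b(t + k). Column operations replace the monomials y^j in the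
-- Hankel matrix by the orthogonal polynomials of L,
--   q_0 = 1,  q_1 = y - 1 - b,  q_{j+2} = (y - 2) q_{j+1} - q_j,
-- so that row i and column j carry L_{i-m}(q_j). For t ≥ 0 the value L_t(q_j)
-- vanishes when t < j and is 1 when t = j, while
--   L_{-1-k}(q_j) = (-1)^{j+k+1} C(j + k, 2k + 1)
-- does not depend on b. Hence the rows i ≥ m are unitriangular and
-- D_{-m}(b; n) is, up to sign, the determinant of the m × m block formed by the
-- first m rows and the last m columns. Its entries are j times polynomials in j²
-- of degrees 0, …, m - 1, so the block is evaluated like a Vandermonde
-- determinant.
module Submission where

open import Defs
open import Algebra.Bundles using (CommutativeRing; Semiring)
open import Algebra.Morphism.Structures using (IsRingHomomorphism)
import Algebra.Definitions.RawSemiring as RawSemiringDefinitions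
import Algebra.Properties.CommutativeMonoid.Sum as CommutativeMonoidSum
import Algebra.Properties.Monoid.Mult as MonoidMult
import Algebra.Properties.Ring as RingProperties
import Algebra.Properties.Semiring.Exp as SemiringExp
import Algebra.Properties.Semiring.Sum as SemiringSum
import Algebra.Solver.Ring.NaturalCoefficients.Default as SemiringSolver
open import Data.Fin.Base using (Fin; zero; suc; toℕ; fromℕ; fromℕ<; inject₁; punchIn)
open import Data.Fin.Properties using (toℕ-fromℕ; toℕ-fromℕ<; toℕ-inject₁; toℕ<n; toℕ≤pred[n])
open import Data.Integer.Base as ℤ using (ℤ; +_; 0ℤ; 1ℤ; -1ℤ)
import Data.Integer.Properties as ℤ
open import Data.Integer.Solver using (module +-*-Solver)
open import Data.Nat.Base as ℕ using (ℕ; zero; suc; _≤_; _∸_; NonZero)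
open import Data.Nat.Combinatorics using (_C_; nC1≡n; k>n⇒nCk≡0; nCk≡nC[n∸k]; nCk+nC[k+1]≡[n+1]C[k+1])
import Data.Nat.Properties as ℕ
open import Data.Product.Base using (_×_; _,_)
open import Data.Rational.Base as ℚ using (ℚ; 0ℚ; 1ℚ)
import Data.Rational.Properties as ℚ
import Data.Rational.Unnormalised.Base as ℚᵘ
import Data.Rational.Unnormalised.Properties as ℚᵘ
open import Data.Vec.Functional using (Vector; _∷_)
open import Function.Base using (_∘_)
import Relation.Binary.Reasoning.Setoid as SetoidReasoning
open import Relation.Binary.PropositionalEquality as ≡ using (_≡_)
open import Relation.Nullary using (yes; no)

-- Determinants

-- On that side b is absorbed by the closed form L_t(q_j) = F (t + j) (t - j), where `F` is a
-- two-index ballot sum with M_b(n) = F n n. Its Pascal rule, applied twice, is the three-term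
-- recurrence, and F t (t + 1) = b F t t accounts for the exceptional q_1. The Vandermonde-like
-- elimination divides by (2k + 2)(2k + 3), so the block is evaluated over the rationals and only
-- the result is carried to R. The result and p_{m+1} are compared through the integer products
-- `num m y`, with p_{m+1}(x) = num m (2x) / num m 0 for integers x. The substitution of -y - 2(m +
-- 1) for y permutes the factors up to sign, which links the values of p_{m+1} at N and at -(N + m +
-- 1).

module Determinant {c ℓ} (R : CommutativeRing c ℓ) where
  open CommutativeRing R hiding (zero)
  open SemiringExp semiring using (_^_)
  open SemiringSum semiring
    using (sum; sum-cong-≋; sum-replicate-zero; sum-init-last; ∑-comm; ∑-distrib-+; *-distribˡ-sum)
  open RawSemiringDefinitions (Semiring.rawSemiring semiring) using (product)
  open RingProperties ring using (-1*x≈-x)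
  open SemiringSolver commutativeSemiring using (solve; _:=_; _:+_; _:*_)
  open SetoidReasoning setoid

  private
    variable
      n : ℕ

  sum-cong : (f g : Vector Carrier n) → (∀ i → f i ≈ g i) → sum f ≈ sum g
  sum-cong f g = sum-cong-≋ {x = f} {y = g}

  sum-zero : (f : Vector Carrier n) → (∀ i → f i ≈ 0#) → sum f ≈ 0#
  sum-zero {n} f f≈0 = trans (sum-cong f (λ _ → 0#) f≈0) (sum-replicate-zero n)

  -1*x+x≈0 : ∀ x → - 1# * x + x ≈ 0#
  -1*x+x≈0 x = trans (+-congʳ (-1*x≈-x x)) (-‿inverseˡ x)

  -1*[-1*x]≈x : ∀ x → - 1# * (- 1# * x) ≈ x
  -1*[-1*x]≈x x = begin
    - 1# * (- 1# * x)                ≈⟨ +-identityʳ _ ⟨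
    - 1# * (- 1# * x) + 0#           ≈⟨ +-congˡ (-1*x+x≈0 x) ⟨
    - 1# * (- 1# * x) + (- 1# * x + x) ≈⟨ +-assoc _ _ _ ⟨
    - 1# * (- 1# * x) + - 1# * x + x ≈⟨ +-congʳ (-1*x+x≈0 (- 1# * x)) ⟩
    0# + x                           ≈⟨ +-identityˡ x ⟩
    x ∎

  rowTerm columnTerm : Matrix R (suc n) → Vector Carrier (suc n)
  rowTerm    A j = ((- 1#) ^ toℕ j * A zero j) * det R (λ i k → A (suc i) (punchIn j k))
  columnTerm A i = ((- 1#) ^ toℕ i * A i zero) * det R (λ r k → A (punchIn i r) (suc k))

  det-cong : (A B : Matrix R n) → (∀ i j → A i j ≈ B i j) → det R A ≈ det R B
  det-cong {zero}  A B A≈B = refl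
  det-cong {suc n} A B A≈B = sum-cong (rowTerm A) (rowTerm B) λ j →
    *-cong (*-congˡ {x = (- 1#) ^ toℕ j} (A≈B zero j)) 
      (det-cong (λ i k → A (suc i) (punchIn j k)) (λ i k → B (suc i) (punchIn j k)) λ i k → A≈B (suc i) (punchIn j k))

  -- `det` is defined along the first row only. Both expansions contain the corner term; expanding
  -- the other minors once more, along the first column or the first row respectively, gives the
  -- same double sum in the two orders of summation.
  det-expand-column : (A : Matrix R (suc n)) → det R A ≈ sum (columnTerm A)
  det-expand-column {zero}  A = refl
  det-expand-column {suc n} A = +-congˡ (begin
    sum (λ j → rowTerm A (suc j))
      ≈⟨ sum-cong (λ j → rowTerm A (suc j)) (λ j → sum (f j))
           (λ j → trans (*-congˡ {x = s j * A zero (suc j)} (det-expand-column (λ i k → A (suc i) (punchIn (suc j) k))))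
                        (*-distribˡ-sum (s j * A zero (suc j)) (columnTerm (λ i k → A (suc i) (punchIn (suc j) k))))) ⟩
    sum (λ j → sum (λ i → f j i))
      ≈⟨ ∑-comm f ⟩
    sum (λ i → sum (λ j → f j i))
      ≈⟨ sum-cong (λ i → sum (λ j → f j i)) (λ i → sum (g i)) (λ i → sum-cong (λ j → f j i) (g i) (λ j →
           solve 6 (λ e x y z w u → (e :* x :* y) :* ((z :* w) :* u) := (e :* z :* w) :* ((x :* y) :* u)) refl
             (- 1#) ((- 1#) ^ toℕ j) (A zero (suc j)) ((- 1#) ^ toℕ i) (A (suc i) zero) (d i j))) ⟩
    sum (λ i → sum (g i))
      ≈⟨ sum-cong (λ i → columnTerm A (suc i)) (λ i → sum (g i))
           (λ i → *-distribˡ-sum (s i * A (suc i) zero) (rowTerm (λ r k → A (punchIn (suc i) r) (suc k)))) ⟨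
    sum (λ i → columnTerm A (suc i)) ∎)
    where
    s : Fin (suc n) → Carrier
    s j = (- 1#) ^ suc (toℕ j)
    d f g : Fin (suc n) → Fin (suc n) → Carrier
    d i j = det R (λ r k → A (suc (punchIn i r)) (suc (punchIn j k)))
    f j i = (s j * A zero (suc j)) * (((- 1#) ^ toℕ i * A (suc i) zero) * d i j)
    g i j = (s i * A (suc i) zero) * (((- 1#) ^ toℕ j * A zero (suc j)) * d i j)

  det-transpose : (A : Matrix R n) → det R (λ i j → A j i) ≈ det R A
  det-transpose {zero}  A = refl
  det-transpose {suc n} A = trans
    (sum-cong (rowTerm (λ i j → A j i)) (columnTerm A)
      λ j → *-congˡ {x = (- 1#) ^ toℕ j * A j zero} (det-transpose (λ r k → A (punchIn j r) (suc k))))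
    (sym (det-expand-column A))

  infixr 5 _∷ᶜ_
  _∷ᶜ_ : ∀ {m} → Vector Carrier m → Vector (Vector Carrier n) m → Vector (Vector Carrier (suc n)) m
  (c ∷ᶜ A) i = c i ∷ A i

  -- Lets an identity for determinants of size n act behind a fixed first column; the inductions on
  -- columns rest on it.
  det-∷ᶜ-cong : (c : Vector Carrier (suc n)) (A B : Vector (Vector Carrier n) (suc n)) →
    (∀ i → det R (A ∘ punchIn i) ≈ det R (B ∘ punchIn i)) → det R (c ∷ᶜ A) ≈ det R (c ∷ᶜ B)
  det-∷ᶜ-cong c A B eq = begin
    det R (c ∷ᶜ A)            ≈⟨ det-expand-column (c ∷ᶜ A) ⟩
    sum (columnTerm (c ∷ᶜ A)) ≈⟨ sum-cong (columnTerm (c ∷ᶜ A)) (columnTerm (c ∷ᶜ B))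
                                   (λ i → *-congˡ {x = (- 1#) ^ toℕ i * c i} (eq i)) ⟩
    sum (columnTerm (c ∷ᶜ B)) ≈⟨ det-expand-column (c ∷ᶜ B) ⟨
    det R (c ∷ᶜ B)            ∎

  det-∷ᶜ-linear : (c d : Vector Carrier (suc n)) (x : Carrier) (A : Vector (Vector Carrier n) (suc n)) →
    det R ((λ i → c i + x * d i) ∷ᶜ A) ≈ det R (c ∷ᶜ A) + x * det R (d ∷ᶜ A)
  det-∷ᶜ-linear c d x A = begin
    det R e                                        ≈⟨ det-expand-column e ⟩
    sum (columnTerm e)                             ≈⟨ sum-cong (columnTerm e) (λ i → f i + x * g i) (λ i →
      solve 5 (λ s u v w z → (s :* (u :+ v :* w)) :* z := s :* u :* z :+ v :* (s :* w :* z)) refl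
           ((- 1#) ^ toℕ i) (c i) x (d i) (det R (A ∘ punchIn i))) ⟩
    sum (λ i → f i + x * g i)                      ≈⟨ ∑-distrib-+ f (λ i → x * g i) ⟩
    sum f + sum (λ i → x * g i)                    ≈⟨ +-congˡ (*-distribˡ-sum x g) ⟨
    sum f + x * sum g                              ≈⟨ +-cong (det-expand-column (c ∷ᶜ A)) (*-congˡ (det-expand-column (d ∷ᶜ A))) ⟨
    det R (c ∷ᶜ A) + x * det R (d ∷ᶜ A)            ∎
    where
    e = (λ i → c i + x * d i) ∷ᶜ A
    f = columnTerm (c ∷ᶜ A)
    g = columnTerm (d ∷ᶜ A)

  private
    punchIn-1 : ∀ {m} (c d : Vector Carrier (suc m)) (A : Vector (Vector Carrier n) (suc m)) →
      ∀ i k → (c ∷ᶜ d ∷ᶜ A) (suc i) (punchIn (suc zero) k) ≈ ((c ∘ suc) ∷ᶜ (A ∘ suc)) i k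
    punchIn-1 c d A i zero    = refl
    punchIn-1 c d A i (suc k) = refl

    punchIn-2+ : ∀ {m} (c d : Vector Carrier (suc m)) (A : Vector (Vector Carrier (suc n)) (suc m)) (j : Fin (suc n)) →
      ∀ i k → (c ∷ᶜ d ∷ᶜ A) (suc i) (punchIn (suc (suc j)) k)
              ≈ ((c ∘ suc) ∷ᶜ (d ∘ suc) ∷ᶜ (λ i k → A (suc i) (punchIn j k))) i k
    punchIn-2+ c d A j i zero          = refl
    punchIn-2+ c d A j i (suc zero)    = refl
    punchIn-2+ c d A j i (suc (suc k)) = refl

  -- In the expansion along the first row the terms of `c zero` and `d zero` trade places and have
  -- opposite signs; in all later terms both columns survive in the minor, and induction on the size
  -- applies.
  det-swap : (c d : Vector Carrier (suc (suc n))) (A : Vector (Vector Carrier n) (suc (suc n))) →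
    det R (c ∷ᶜ d ∷ᶜ A) ≈ - 1# * det R (d ∷ᶜ c ∷ᶜ A)
  det-swap {n} c d A = begin
    (1# * c zero) * x + ((- 1# * 1# * d zero) * y + rest c d)
      ≈⟨ +-cong (sym (-1*[-1*x]≈x _)) (+-cong (*-congˡ (det-cong _ ((c ∘ suc) ∷ᶜ (A ∘ suc)) (punchIn-1 c d A))) (sum-cong (r c d) (λ j → - 1# * r d c j) rest-swap)) ⟩
    - 1# * (- 1# * ((1# * c zero) * x)) + ((- 1# * 1# * d zero) * x′ + sum λ j → - 1# * r d c j)
      ≈⟨ +-cong (*-congˡ (*-congˡ (*-congˡ (sym (det-cong _ ((d ∘ suc) ∷ᶜ (A ∘ suc)) (punchIn-1 d c A)))))) (+-congˡ (sym (*-distribˡ-sum (- 1#) (r d c)))) ⟩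
    - 1# * (- 1# * ((1# * c zero) * y′)) + ((- 1# * 1# * d zero) * x′ + - 1# * rest d c)
      ≈⟨ solve 7 (λ e u c d y x t → e :* (e :* (u :* c :* y)) :+ (e :* u :* d :* x :+ e :* t)
                    := e :* (u :* d :* x :+ (e :* u :* c :* y :+ t))) refl
           (- 1#) 1# (c zero) (d zero) y′ x′ (rest d c) ⟩
    - 1# * ((1# * d zero) * x′ + ((- 1# * 1# * c zero) * y′ + rest d c)) ∎
    where
    x = det R ((d ∘ suc) ∷ᶜ (A ∘ suc))
    y = det R (λ i k → (c ∷ᶜ d ∷ᶜ A) (suc i) (punchIn (suc zero) k))
    x′ = det R ((c ∘ suc) ∷ᶜ (A ∘ suc))
    y′ = det R (λ i k → (d ∷ᶜ c ∷ᶜ A) (suc i) (punchIn (suc zero) k))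
    r : (c d : Vector Carrier (suc (suc n))) → Fin n → Carrier
    r c d j = ((- 1#) ^ suc (suc (toℕ j)) * A zero j)
              * det R (λ i k → (c ∷ᶜ d ∷ᶜ A) (suc i) (punchIn (suc (suc j)) k))
    rest : (c d : Vector Carrier (suc (suc n))) → Carrier
    rest c d = sum (r c d)
    swap-minor : ∀ {n} (c d : Vector Carrier (suc (suc n))) (A : Vector (Vector Carrier n) (suc (suc n))) (j : Fin n) →
      det R (λ i k → (c ∷ᶜ d ∷ᶜ A) (suc i) (punchIn (suc (suc j)) k))
      ≈ - 1# * det R (λ i k → (d ∷ᶜ c ∷ᶜ A) (suc i) (punchIn (suc (suc j)) k))
    swap-minor {suc n} c d A j = begin
      det R (minor c d)    ≈⟨ det-cong (minor c d) (c′ ∷ᶜ d′ ∷ᶜ A′) (punchIn-2+ c d A j) ⟩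
      det R (c′ ∷ᶜ d′ ∷ᶜ A′) ≈⟨ det-swap c′ d′ A′ ⟩
      - 1# * det R (d′ ∷ᶜ c′ ∷ᶜ A′) ≈⟨ *-congˡ (det-cong (minor d c) (d′ ∷ᶜ c′ ∷ᶜ A′) (punchIn-2+ d c A j)) ⟨
      - 1# * det R (minor d c) ∎
      where
      c′ = c ∘ suc
      d′ = d ∘ suc
      A′ = λ i k → A (suc i) (punchIn j k)
      minor : (c d : Vector Carrier _) → Matrix R _
      minor c d i k = (c ∷ᶜ d ∷ᶜ A) (suc i) (punchIn (suc (suc j)) k)
    rest-swap : ∀ j → r c d j ≈ - 1# * r d c j
    rest-swap j = trans (*-congˡ (swap-minor c d A j))
      (solve 3 (λ a e y → a :* (e :* y) := e :* (a :* y)) refl _ (- 1#) _)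

  -- Needs an induction of its own: over a general commutative ring `det-swap` yields only that
  -- twice the determinant is zero.
  det-equal-columns : (c : Vector Carrier (suc (suc n))) (A : Vector (Vector Carrier n) (suc (suc n))) →
    det R (c ∷ᶜ c ∷ᶜ A) ≈ 0#
  det-equal-columns {n} c A = begin
    (1# * c zero) * x + ((- 1# * 1# * c zero) * y + sum rest)
      ≈⟨ +-congˡ (+-cong (*-congˡ (det-cong _ ((c ∘ suc) ∷ᶜ (A ∘ suc)) (punchIn-1 c c A))) (sum-zero rest λ j → trans (*-congˡ {x = (- 1#) ^ suc (suc (toℕ j)) * A zero j} (equal-minor c A j)) (zeroʳ _))) ⟩
    (1# * c zero) * x + ((- 1# * 1# * c zero) * x + 0#)
      ≈⟨ +-congˡ (+-identityʳ _) ⟩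
    (1# * c zero) * x + (- 1# * 1# * c zero) * x
      ≈⟨ solve 4 (λ u c e x → u :* c :* x :+ e :* u :* c :* x := e :* (u :* c :* x) :+ u :* c :* x) refl
           1# (c zero) (- 1#) x ⟩
    - 1# * ((1# * c zero) * x) + (1# * c zero) * x
      ≈⟨ -1*x+x≈0 _ ⟩
    0# ∎
    where
    x = det R ((c ∘ suc) ∷ᶜ (A ∘ suc))
    y = det R (λ i k → (c ∷ᶜ c ∷ᶜ A) (suc i) (punchIn (suc zero) k))
    rest : Fin n → Carrier
    rest j = ((- 1#) ^ suc (suc (toℕ j)) * A zero j)
              * det R (λ i k → (c ∷ᶜ c ∷ᶜ A) (suc i) (punchIn (suc (suc j)) k))
    equal-minor : ∀ {n} (c : Vector Carrier (suc (suc n))) (A : Vector (Vector Carrier n) (suc (suc n))) (j : Fin n) →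
      det R (λ i k → (c ∷ᶜ c ∷ᶜ A) (suc i) (punchIn (suc (suc j)) k)) ≈ 0#
    equal-minor {suc n} c A j =
      trans (det-cong _ ((c ∘ suc) ∷ᶜ (c ∘ suc) ∷ᶜ (λ i k → A (suc i) (punchIn j k))) (punchIn-2+ c c A j)) (det-equal-columns (c ∘ suc) (λ i k → A (suc i) (punchIn j k)))

  det-add-first-to-second : (c d : Vector Carrier (suc (suc n))) (x : Carrier) (A : Vector (Vector Carrier n) (suc (suc n))) →
    det R (c ∷ᶜ (λ i → d i + x * c i) ∷ᶜ A) ≈ det R (c ∷ᶜ d ∷ᶜ A)
  det-add-first-to-second c d x A = begin
    det R (c ∷ᶜ (λ i → d i + x * c i) ∷ᶜ A)                     ≈⟨ det-swap c (λ i → d i + x * c i) A ⟩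
    - 1# * det R ((λ i → d i + x * c i) ∷ᶜ c ∷ᶜ A)              ≈⟨ *-congˡ (det-∷ᶜ-linear d c x (c ∷ᶜ A)) ⟩
    - 1# * (det R (d ∷ᶜ c ∷ᶜ A) + x * det R (c ∷ᶜ c ∷ᶜ A))      ≈⟨ *-congˡ (+-congˡ (trans (*-congˡ (det-equal-columns c A)) (zeroʳ x))) ⟩
    - 1# * (det R (d ∷ᶜ c ∷ᶜ A) + 0#)                           ≈⟨ *-congˡ (+-identityʳ _) ⟩
    - 1# * det R (d ∷ᶜ c ∷ᶜ A)                                  ≈⟨ det-swap c d A ⟨
    det R (c ∷ᶜ d ∷ᶜ A)                                         ∎

  -- The second column is cleared directly. Swapped to the front, it leaves `c` as the first column
  -- of every minor, so induction clears the rest.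
  det-add-first : (c : Vector Carrier (suc n)) (x : Vector Carrier n) (A : Vector (Vector Carrier n) (suc n)) →
    det R (c ∷ᶜ (λ i k → A i k + x k * c i)) ≈ det R (c ∷ᶜ A)
  det-add-first {zero}  c x A = det-cong (c ∷ᶜ (λ i k → A i k + x k * c i)) (c ∷ᶜ A) λ { i zero → refl }
  det-add-first {suc n} c x A = begin
    det R (c ∷ᶜ A⁺)                                    ≈⟨ det-cong (c ∷ᶜ A⁺) (c ∷ᶜ a⁺ ∷ᶜ A″) (λ { i zero → refl ; i (suc zero) → refl ; i (suc (suc k)) → refl }) ⟩
    det R (c ∷ᶜ a⁺ ∷ᶜ A″)                              ≈⟨ det-add-first-to-second c a (x zero) A″ ⟩
    det R (c ∷ᶜ a ∷ᶜ A″)                               ≈⟨ det-swap c a A″ ⟩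
    - 1# * det R (a ∷ᶜ c ∷ᶜ A″)                        ≈⟨ *-congˡ (det-∷ᶜ-cong a (c ∷ᶜ A″) (c ∷ᶜ A′) λ i →
                                                            det-add-first (c ∘ punchIn i) (x ∘ suc) (A′ ∘ punchIn i)) ⟩
    - 1# * det R (a ∷ᶜ c ∷ᶜ A′)                        ≈⟨ det-swap c a A′ ⟨
    det R (c ∷ᶜ a ∷ᶜ A′)                               ≈⟨ det-cong (c ∷ᶜ a ∷ᶜ A′) (c ∷ᶜ A) (λ { i zero → refl ; i (suc zero) → refl ; i (suc (suc k)) → refl }) ⟩
    det R (c ∷ᶜ A)                                     ∎
    where
    a  = λ i → A i zero
    a⁺ = λ i → a i + x zero * c i
    A⁺ = λ i k → A i k + x k * c i
    A′ = λ i k → A i (suc k)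
    A″ = λ i k → A′ i k + x (suc k) * c i

  -- The product has the first column of `A`. Every other column contains a multiple of it, which
  -- `det-add-first` removes, and what remains is a product with a smaller unitriangular matrix.
  det-unitriangular : (A U : Matrix R n) →
    (∀ l k → toℕ k ℕ.< toℕ l → U l k ≈ 0#) → (∀ k → U k k ≈ 1#) →
    det R (λ i k → sum λ l → A i l * U l k) ≈ det R A
  det-unitriangular {zero}  A U U≈0 U≈1 = refl
  det-unitriangular {suc n} A U U≈0 U≈1 = begin
    det R AU
      ≈⟨ det-cong AU (a ∷ᶜ B⁺)
           (λ { i zero → first i ; i (suc k) → trans (+-congʳ (*-comm (A i zero) (U zero (suc k)))) (+-comm _ _) }) ⟩
    det R (a ∷ᶜ B⁺)
      ≈⟨ det-add-first a (λ k → U zero (suc k)) B ⟩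
    det R (a ∷ᶜ B)
      ≈⟨ det-∷ᶜ-cong a B A′ (λ i → det-unitriangular (A′ ∘ punchIn i) (λ l k → U (suc l) (suc k))
           (λ l k k<l → U≈0 (suc l) (suc k) (ℕ.s≤s k<l)) (λ k → U≈1 (suc k))) ⟩
    det R (a ∷ᶜ A′)
      ≈⟨ det-cong (a ∷ᶜ A′) A (λ { i zero → refl ; i (suc k) → refl }) ⟩
    det R A ∎
    where
    a = λ i → A i zero
    A′ = λ i k → A i (suc k)
    AU = λ i k → sum λ l → A i l * U l k
    B  = λ i k → sum λ l → A′ i l * U (suc l) (suc k)
    B⁺ = λ i k → B i k + U zero (suc k) * a i
    first : ∀ i → (sum λ l → A i l * U l zero) ≈ a i
    first i = begin
      A i zero * U zero zero + (sum λ l → A i (suc l) * U (suc l) zero)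
        ≈⟨ +-cong (trans (*-congˡ (U≈1 zero)) (*-identityʳ _))
                  (sum-zero (λ l → A i (suc l) * U (suc l) zero) λ l →
                     trans (*-congˡ (U≈0 (suc l) zero (ℕ.s≤s ℕ.z≤n))) (zeroʳ _)) ⟩
      A i zero + 0# ≈⟨ +-identityʳ _ ⟩
      A i zero ∎

  -- The later columns are restored first, by induction on the minors. The first column then differs
  -- from its original by a multiple of a column that stands unaltered beside it.
  det-add-next : (A B : Matrix R (suc n)) (x : Vector Carrier n) →
    (∀ i k → B i (inject₁ k) ≈ A i (inject₁ k) + x k * A i (suc k)) →
    (∀ i → B i (fromℕ n) ≈ A i (fromℕ n)) → det R B ≈ det R A
  det-add-next {zero}  A B x B≈ Bₙ≈ = det-cong B A λ { i zero → Bₙ≈ i }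
  det-add-next {suc n} A B x B≈ Bₙ≈ = begin
    det R B
      ≈⟨ det-cong B (a⁺ ∷ᶜ B′) (λ { i zero → B≈ i zero ; i (suc k) → refl }) ⟩
    det R (a⁺ ∷ᶜ B′)
      ≈⟨ det-∷ᶜ-cong a⁺ B′ A′ (λ i → det-add-next (A′ ∘ punchIn i) (B′ ∘ punchIn i) (x ∘ suc)
           (λ r k → B≈ (punchIn i r) (suc k)) (λ r → Bₙ≈ (punchIn i r))) ⟩
    det R (a⁺ ∷ᶜ A′)
      ≈⟨ det-∷ᶜ-linear a a′ (x zero) A′ ⟩
    det R (a ∷ᶜ A′) + x zero * det R (a′ ∷ᶜ A′)
      ≈⟨ +-cong (det-cong (a ∷ᶜ A′) A λ { i zero → refl ; i (suc k) → refl })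
           (trans (*-congˡ {x = x zero} (trans
              (det-cong (a′ ∷ᶜ A′) (a′ ∷ᶜ a′ ∷ᶜ A″) λ { i zero → refl ; i (suc zero) → refl ; i (suc (suc k)) → refl })
              (det-equal-columns a′ A″))) (zeroʳ _)) ⟩
    det R A + 0#
      ≈⟨ +-identityʳ _ ⟩
    det R A ∎
    where
    a  = λ i → A i zero
    a′ = λ i → A i (suc zero)
    a⁺ = λ i → a i + x zero * a′ i
    A′ = λ i k → A i (suc k)
    A″ = λ i k → A i (suc (suc k))
    B′ = λ i k → B i (suc k)

  det-zero-row : (A : Matrix R n) (r : Fin n) → (∀ k → A r k ≈ 0#) → det R A ≈ 0#
  det-zero-row A zero    A≈0 = sum-zero (rowTerm A) λ j →
    trans (*-congʳ (trans (*-congˡ (A≈0 j)) (zeroʳ _))) (zeroˡ _)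
  det-zero-row {suc n} A (suc r) A≈0 = sum-zero (rowTerm A) λ j →
    trans (*-congˡ {x = (- 1#) ^ toℕ j * A zero j}
      (det-zero-row (λ i k → A (suc i) (punchIn j k)) r (λ k → A≈0 (punchIn j k)))) (zeroʳ _)

  -- For a lower row, the minor without column 0 contains a zero row, and every other minor keeps
  -- the unit row; each step down costs a factor -1.
  det-unit-row : (A : Matrix R (suc n)) (r : Fin (suc n)) →
    A r zero ≈ 1# → (∀ k → A r (suc k) ≈ 0#) →
    det R A ≈ (- 1#) ^ toℕ r * det R (λ i k → A (punchIn r i) (suc k))
  det-unit-row A zero A≈1 A≈0 = begin
    rowTerm A zero + sum (λ j → rowTerm A (suc j))
      ≈⟨ +-cong (*-congʳ (trans (*-congˡ A≈1) (*-identityʳ 1#)))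
           (sum-zero (λ j → rowTerm A (suc j)) λ j → trans (*-congʳ (trans (*-congˡ (A≈0 j)) (zeroʳ _))) (zeroˡ _)) ⟩
    1# * d + 0#  ≈⟨ +-identityʳ _ ⟩
    1# * d       ∎
    where d = det R (λ i k → A (suc i) (suc k))
  det-unit-row {suc n} A (suc r) A≈1 A≈0 = begin
    rowTerm A zero + sum (λ j → rowTerm A (suc j))
      ≈⟨ +-cong (trans (*-congˡ {x = 1# * A zero zero} (det-zero-row (λ i k → A (suc i) (suc k)) r A≈0)) (zeroʳ _))
           (sum-cong (λ j → rowTerm A (suc j)) f λ j → trans
             (*-congˡ {x = (- 1#) ^ suc (toℕ j) * A zero (suc j)}
               (det-unit-row (λ i k → A (suc i) (punchIn (suc j) k)) r A≈1 (λ k → A≈0 (punchIn j k))))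
             (solve 5 (λ e s a t d → (e :* s :* a) :* (t :* d) := (e :* t) :* ((s :* a) :* d)) refl
               (- 1#) ((- 1#) ^ toℕ j) (A zero (suc j)) ((- 1#) ^ toℕ r) (d j))) ⟩
    0# + sum f
      ≈⟨ +-identityˡ _ ⟩
    sum f
      ≈⟨ *-distribˡ-sum ((- 1#) ^ suc (toℕ r)) (rowTerm A′) ⟨
    (- 1#) ^ suc (toℕ r) * sum (rowTerm A′) ∎
    where
    A′ : Matrix R (suc n)
    A′ i k = A (punchIn (suc r) i) (suc k)
    d f : Fin (suc n) → Carrier
    d j = det R (λ i k → A′ (suc i) (punchIn j k))
    f j = (- 1#) ^ suc (toℕ r) * rowTerm A′ j

  punchIn-fromℕ : (k : Fin n) → punchIn (fromℕ n) k ≡ inject₁ k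
  punchIn-fromℕ zero    = ≡.refl
  punchIn-fromℕ (suc k) = ≡.cong suc (punchIn-fromℕ k)

  det-expand-last : (A : Matrix R (suc n)) → (∀ k → A zero (inject₁ k) ≈ 0#) →
    det R A ≈ ((- 1#) ^ n * A zero (fromℕ n)) * det R (λ i k → A (suc i) (inject₁ k))
  det-expand-last {n} A A≈0 = begin
    sum t                              ≈⟨ sum-init-last t ⟩
    sum (t ∘ inject₁) + t (fromℕ n)    ≈⟨ +-congʳ (sum-zero (t ∘ inject₁) λ k →
                                            trans (*-congʳ (trans (*-congˡ (A≈0 k)) (zeroʳ _))) (zeroˡ _)) ⟩
    0# + t (fromℕ n)                   ≈⟨ +-identityˡ _ ⟩
    t (fromℕ n)                        ≈⟨ *-cong (*-congʳ (reflexive (≡.cong ((- 1#) ^_) (toℕ-fromℕ n))))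
                                            (det-cong (λ i k → A (suc i) (punchIn (fromℕ n) k)) (λ i k → A (suc i) (inject₁ k)) λ i k → reflexive (≡.cong (A (suc i)) (punchIn-fromℕ k))) ⟩
    ((- 1#) ^ n * A zero (fromℕ n)) * det R (λ i k → A (suc i) (inject₁ k)) ∎
    where
    t : Vector Carrier (suc n)
    t = rowTerm A

  det-scale-rows : (c : Vector Carrier n) (A : Matrix R n) →
    det R (λ i j → c i * A i j) ≈ product c * det R A
  det-scale-rows {zero}  c A = sym (*-identityˡ 1#)
  det-scale-rows {suc n} c A = begin
    sum (rowTerm (λ i j → c i * A i j))
      ≈⟨ sum-cong (rowTerm (λ i j → c i * A i j)) (λ j → product c * rowTerm A j) (λ j → trans
           (*-congˡ {x = (- 1#) ^ toℕ j * (c zero * A zero j)} (det-scale-rows (c ∘ suc) (λ i k → A (suc i) (punchIn j k))))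
           (solve 5 (λ s u a v d → (s :* (u :* a)) :* (v :* d) := (u :* v) :* ((s :* a) :* d)) refl
             ((- 1#) ^ toℕ j) (c zero) (A zero j) (product (c ∘ suc)) (det R (λ i k → A (suc i) (punchIn j k))))) ⟩
    sum (λ j → product c * rowTerm A j)
      ≈⟨ *-distribˡ-sum (product c) (rowTerm A) ⟨
    product c * det R A ∎

  det-scale-columns : (c : Vector Carrier n) (A : Matrix R n) →
    det R (λ i j → c j * A i j) ≈ product c * det R A
  det-scale-columns c A = begin
    det R (λ i j → c j * A i j)       ≈⟨ det-transpose (λ i j → c j * A i j) ⟨
    det R (λ i j → c i * A j i)       ≈⟨ det-scale-rows c (λ i j → A j i) ⟩
    product c * det R (λ i j → A j i) ≈⟨ *-congˡ (det-transpose A) ⟩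
    product c * det R A               ∎

-- The functionals L_t and the reduction to an m × m block

module Moments {c ℓ} (R : CommutativeRing c ℓ) (b : CommutativeRing.Carrier R) where
  open CommutativeRing R hiding (zero)
  open SemiringExp semiring using (_^_)
  open MonoidMult +-monoid using (×-homo-+) renaming (_×_ to _·_)
  open SemiringSum semiring using (sum; sum-init-last; ∑-distrib-+; *-distribˡ-sum)
  open RingProperties ring using (-0#≈0#; -‿+-comm; +-cancelʳ; x≈y⇒x∙y⁻¹≈ε)
  open SemiringSolver commutativeSemiring using (solve; _:=_; _:+_; _:*_)
  open SetoidReasoning setoid
  open Determinant R

  -- For k ≤ r, the ballot number counting lattice paths with r up-steps and k down-steps that never
  -- fall below their start.
  ballot : ℕ → ℕ → Carrier
  ballot r k = ((r ℕ.+ k) C k) · 1# - ((r ℕ.+ k) C-pred k) · 1#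

  ballot-zero : ∀ r → ballot r 0 ≈ 1#
  ballot-zero r = begin
    1# + 0# - 0# ≈⟨ +-cong (+-identityʳ 1#) -0#≈0# ⟩
    1# + 0#      ≈⟨ +-identityʳ 1# ⟩
    1#           ∎

  ballot-diagonal : ∀ t → ballot t (suc t) ≈ 0#
  ballot-diagonal t = x≈y⇒x∙y⁻¹≈ε (reflexive (≡.cong (_· 1#) (≡.sym
    (≡.trans (nCk≡nC[n∸k] (ℕ.m≤m+n t (suc t))) (≡.cong ((t ℕ.+ suc t) C_) (ℕ.m+n∸m≡n t (suc t)))))))

  ballot-suc : ∀ r k → ballot (suc r) (suc k) ≈ ballot r (suc k) + ballot (suc r) k
  ballot-suc r k = begin
    ballot (suc r) (suc k)
      ≡⟨ ≡.cong₂ (λ x y → x · 1# - y · 1#) pascal (pascal-pred k) ⟩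
    (x₁ ℕ.+ x₂) · 1# - (y₁ ℕ.+ y₂) · 1#
      ≈⟨ +-cong (×-homo-+ 1# x₁ x₂) (trans (-‿cong (×-homo-+ 1# y₁ y₂)) (sym (-‿+-comm _ _))) ⟩
    (x₁ · 1# + x₂ · 1#) + (- (y₁ · 1#) + - (y₂ · 1#))
      ≈⟨ solve 4 (λ x y z w → (x :+ y) :+ (z :+ w) := (x :+ z) :+ (y :+ w)) refl _ _ _ _ ⟩
    ballot r (suc k) + ballot (suc r) k ∎
    where
    x₁ = (r ℕ.+ suc k) C suc k
    x₂ = (suc r ℕ.+ k) C k
    y₁ = (r ℕ.+ suc k) C k
    y₂ = (suc r ℕ.+ k) C-pred k
    shift : ∀ k l → (r ℕ.+ suc k) C l ≡ (suc r ℕ.+ k) C l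
    shift k l = ≡.cong (_C l) (ℕ.+-suc r k)
    pascal : (suc r ℕ.+ suc k) C suc k ≡ x₁ ℕ.+ x₂
    pascal = ≡.trans (≡.sym (nCk+nC[k+1]≡[n+1]C[k+1] (r ℕ.+ suc k) k))
      (≡.trans (ℕ.+-comm y₁ x₁) (≡.cong (x₁ ℕ.+_) (shift k k)))
    pascal-pred : ∀ k → (suc r ℕ.+ suc k) C k ≡ (r ℕ.+ suc k) C k ℕ.+ (suc r ℕ.+ k) C-pred k
    pascal-pred zero    = ≡.refl
    pascal-pred (suc k) = ≡.trans (≡.sym (nCk+nC[k+1]≡[n+1]C[k+1] (r ℕ.+ suc (suc k)) k))
      (≡.trans (ℕ.+-comm ((r ℕ.+ suc (suc k)) C k) _) (≡.cong (((r ℕ.+ suc (suc k)) C suc k) ℕ.+_) (shift (suc k) k)))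

  F-term : ℕ → (d : ℕ) → Vector Carrier (suc d)
  F-term r d k = ballot r (toℕ k) * b ^ (d ∸ toℕ k)

  -- M_b(n) is the diagonal value `F n n`; the indices are separated because L_t(q_j) is the value
  -- at r = t + j and d = t - j.
  F : ℕ → ℕ → Carrier
  F r d = sum (F-term r d)

  F-zero : ∀ r → F r 0 ≈ 1#
  F-zero r = begin
    ballot r 0 * 1# + 0# ≈⟨ +-identityʳ _ ⟩
    ballot r 0 * 1#      ≈⟨ *-identityʳ _ ⟩
    ballot r 0           ≈⟨ ballot-zero r ⟩
    1#                   ∎

  F-suc : ∀ r d → F (suc r) (suc d) ≈ F r (suc d) + F (suc r) d
  F-suc r d = begin
    F-term (suc r) (suc d) zero + sum (F-term (suc r) (suc d) ∘ suc)
      ≈⟨ +-cong (*-congʳ (trans (ballot-zero (suc r)) (sym (ballot-zero r))))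
           (sum-cong (F-term (suc r) (suc d) ∘ suc) (λ k → F-term r (suc d) (suc k) + F-term (suc r) d k) λ k →
             trans (*-congʳ (ballot-suc r (toℕ k))) (distribʳ _ _ _)) ⟩
    F-term r (suc d) zero + sum (λ k → F-term r (suc d) (suc k) + F-term (suc r) d k)
      ≈⟨ +-congˡ (∑-distrib-+ (F-term r (suc d) ∘ suc) (F-term (suc r) d)) ⟩
    F-term r (suc d) zero + (sum (F-term r (suc d) ∘ suc) + F (suc r) d)
      ≈⟨ +-assoc _ _ _ ⟨
    F r (suc d) + F (suc r) d ∎

  -- The extra last summand has a ballot number just past the diagonal, which is zero; in the others
  -- the exponent of b is one higher.
  F-diagonal : ∀ t → F t (suc t) ≈ b * F t t
  F-diagonal t = begin
    F t (suc t)
      ≈⟨ sum-init-last f ⟩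
    sum (f ∘ inject₁) + f (fromℕ (suc t))
      ≈⟨ +-cong (sum-cong (f ∘ inject₁) (λ k → b * F-term t t k) init)
           (trans (*-congʳ (trans (reflexive (≡.cong (ballot t) (toℕ-fromℕ (suc t)))) (ballot-diagonal t))) (zeroˡ _)) ⟩
    sum (λ k → b * F-term t t k) + 0#
      ≈⟨ +-identityʳ _ ⟩
    sum (λ k → b * F-term t t k)
      ≈⟨ *-distribˡ-sum b (F-term t t) ⟨
    b * F t t ∎
    where
    f = F-term t (suc t)
    init : ∀ k → f (inject₁ k) ≈ b * F-term t t k
    init k = begin
      f (inject₁ k)
        ≡⟨ ≡.cong (λ l → ballot t l * b ^ (suc t ∸ l)) (toℕ-inject₁ k) ⟩
      ballot t (toℕ k) * b ^ (suc t ∸ toℕ k)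
        ≡⟨ ≡.cong (λ l → ballot t (toℕ k) * b ^ l) (ℕ.+-∸-assoc 1 (toℕ≤pred[n] k)) ⟩
      ballot t (toℕ k) * (b * b ^ (t ∸ toℕ k))
        ≈⟨ solve 3 (λ x y z → x :* (y :* z) := y :* (x :* z)) refl _ _ _ ⟩
      b * F-term t t k ∎

  -- F r (t - j), where F r d = 0 for d < 0.
  F⁻ : ℕ → ℕ → ℕ → Carrier
  F⁻ r t       zero    = F r t
  F⁻ r zero    (suc j) = 0#
  F⁻ r (suc t) (suc j) = F⁻ r t j

  F⁻-suc : ∀ r t j → F⁻ (suc r) t j ≈ F⁻ r t j + F⁻ (suc r) t (suc j)
  F⁻-suc r zero    zero    = trans (F-zero (suc r)) (trans (sym (F-zero r)) (sym (+-identityʳ _)))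
  F⁻-suc r (suc t) zero    = F-suc r t
  F⁻-suc r zero    (suc j) = sym (+-identityʳ 0#)
  F⁻-suc r (suc t) (suc j) = F⁻-suc r t j

  F⁻-below : ∀ r t j → t ℕ.< j → F⁻ r t j ≈ 0#
  F⁻-below r zero    (suc j) t<j = refl
  F⁻-below r (suc t) (suc j) (ℕ.s≤s t<j) = F⁻-below r t j t<j

  F⁻-diagonal : ∀ r t → F⁻ r t t ≈ 1#
  F⁻-diagonal r zero    = F-zero r
  F⁻-diagonal r (suc t) = F⁻-diagonal r t

  -- μ m r = M b (r - m)
  μ : ℕ → ℕ → Carrier
  μ zero    r       = F r r
  μ (suc m) zero    = 0#
  μ (suc m) (suc r) = μ m r

  μ-below : ∀ m r → r ℕ.< m → μ m r ≈ 0#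
  μ-below (suc m) zero    r<m = refl
  μ-below (suc m) (suc r) (ℕ.s≤s r<m) = μ-below m r r<m

  M-⊖ : ∀ m r → M R b (r ℤ.⊖ m) ≈ μ m r
  M-⊖ zero    r       = refl
  M-⊖ (suc m) zero    = refl
  M-⊖ (suc m) (suc r) = trans (reflexive (≡.cong (M R b) (ℤ.[1+m]⊖[1+n]≡m⊖n r m))) (M-⊖ m r)

  M-shift : ∀ m i j → M R b (ℤ.- (+ m) ℤ.+ + i ℤ.+ + j) ≈ μ m (i ℕ.+ j)
  M-shift m i j = trans (reflexive (≡.cong (M R b) (≡.trans
    (ℤ.+-assoc (ℤ.- (+ m)) (+ i) (+ j)) (ℤ.-m+n≡n⊖m m (i ℕ.+ j))))) (M-⊖ m (i ℕ.+ j))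

  hankel : ∀ m n → Matrix R n
  hankel m n i j = μ m (toℕ i ℕ.+ toℕ j)

  D-hankel : ∀ m n → D R (ℤ.- (+ m)) b n ≈ det R (hankel m n)
  D-hankel m n = det-cong (λ i j → M R b (ℤ.- (+ m) ℤ.+ + toℕ i ℤ.+ + toℕ j)) (hankel m n)
    (λ i j → M-shift m (toℕ i) (toℕ j))

  -- The first row is M_b(-m), ..., M_b(-m + n - 1), all of negative index.
  D-vanishes : ∀ m n → 1 ℕ.≤ n → n ℕ.≤ m → D R (ℤ.- (+ m)) b n ≈ 0#
  D-vanishes m (suc n) _ n≤m = trans (D-hankel m (suc n))
    (det-zero-row (hankel m (suc n)) zero (λ k → μ-below m (toℕ k) (ℕ.<-≤-trans (toℕ<n k) n≤m)))

  -- u j l is the coefficient of y^l in the orthogonal polynomial q_j.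
  u : ℕ → ℕ → Carrier
  u 0             0       = 1#
  u 0             (suc l) = 0#
  u 1             0       = - (1# + b)
  u 1             (suc l) = u 0 l
  u (suc (suc j)) 0       = 0# - (u (suc j) 0 + u (suc j) 0 + u j 0)
  u (suc (suc j)) (suc l) = u (suc j) l - (u (suc j) (suc l) + u (suc j) (suc l) + u j (suc l))

  x-[y+y+z]≈x : ∀ {x y z} → y ≈ 0# → z ≈ 0# → x - (y + y + z) ≈ x
  x-[y+y+z]≈x {x} {y} {z} y≈0 z≈0 = begin
    x - (y + y + z)    ≈⟨ +-congˡ (-‿cong (+-cong (+-cong y≈0 y≈0) z≈0)) ⟩
    x - (0# + 0# + 0#) ≈⟨ +-congˡ (-‿cong (trans (+-identityʳ _) (+-identityʳ _))) ⟩
    x - 0#             ≈⟨ +-congˡ -0#≈0# ⟩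
    x + 0#             ≈⟨ +-identityʳ x ⟩
    x                  ∎

  x-y+y≈x : ∀ x y → x - y + y ≈ x
  x-y+y≈x x y = trans (+-assoc x (- y) y) (trans (+-congˡ (-‿inverseˡ y)) (+-identityʳ x))

  u-above : ∀ j l → j ℕ.< l → u j l ≈ 0#
  u-above zero          (suc l)       _           = refl
  u-above (suc zero)    (suc (suc l)) _           = refl
  u-above (suc zero)    (suc zero)    (ℕ.s≤s ())
  u-above (suc (suc j)) (suc l)       (ℕ.s≤s j<l) = trans
    (x-[y+y+z]≈x (u-above (suc j) (suc l) (ℕ.m<n⇒m<1+n j<l)) (u-above j (suc l) (ℕ.m<n⇒m<1+n (ℕ.<⇒≤ j<l))))
    (u-above (suc j) l j<l)

  u-diagonal : ∀ j → u j j ≈ 1#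
  u-diagonal zero          = refl
  u-diagonal (suc zero)    = refl
  u-diagonal (suc (suc j)) = trans
    (x-[y+y+z]≈x (u-above (suc j) (suc (suc j)) ℕ.≤-refl) (u-above j (suc (suc j)) (ℕ.n≤1+n _)))
    (u-diagonal (suc j))

  -- The functionals applied to the orthogonal polynomials

  S-term : ∀ m j i n → Vector Carrier n
  S-term m j i n l = μ m (i ℕ.+ toℕ l) * u j (toℕ l)

  -- An entry of the Hankel matrix times the coefficient matrix. Since q_j has degree j, the cutoff
  -- n loses nothing once j < n.
  S : (m j i n : ℕ) → Carrier
  S m j i n = sum (S-term m j i n)

  S-0 : ∀ m i n → S m 0 i (suc n) ≈ μ m i
  S-0 m i n = begin
    μ m (i ℕ.+ 0) * 1# + sum (S-term m 0 i (suc n) ∘ suc) ≈⟨ +-cong (*-identityʳ _) (sum-zero (S-term m 0 i (suc n) ∘ suc) (λ l → zeroʳ _)) ⟩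
    μ m (i ℕ.+ 0) + 0#                                    ≈⟨ +-identityʳ _ ⟩
    μ m (i ℕ.+ 0)                                         ≡⟨ ≡.cong (μ m) (ℕ.+-identityʳ i) ⟩
    μ m i                                                 ∎

  S-1 : ∀ m i n → S m 1 i (suc (suc n)) + (1# + b) * μ m i ≈ μ m (suc i)
  S-1 m i n = begin
    μ m (i ℕ.+ 0) * - (1# + b) + sum (S-term m 1 i (suc (suc n)) ∘ suc) + (1# + b) * μ m i
      ≈⟨ +-congʳ (+-cong (*-congʳ (reflexive (≡.cong (μ m) (ℕ.+-identityʳ i))))
           (sum-cong (S-term m 1 i (suc (suc n)) ∘ suc) (S-term m 0 (suc i) (suc n))
             (λ l → *-congʳ (reflexive (≡.cong (μ m) (ℕ.+-suc i (toℕ l))))))) ⟩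
    μ m i * - (1# + b) + S m 0 (suc i) (suc n) + (1# + b) * μ m i
      ≈⟨ solve 4 (λ x y z s → x :* y :+ s :+ z :* x := s :+ x :* (y :+ z)) refl (μ m i) (- (1# + b)) (1# + b) _ ⟩
    S m 0 (suc i) (suc n) + μ m i * (- (1# + b) + (1# + b))
      ≈⟨ +-cong (S-0 m (suc i) n) (trans (*-congˡ (-‿inverseˡ _)) (zeroʳ _)) ⟩
    μ m (suc i) + 0#
      ≈⟨ +-identityʳ _ ⟩
    μ m (suc i) ∎

  -- Multiplication by y shifts the coefficients by one; this moves row i to row i + 1 and uses up
  -- one term of the sum.
  S-2+ : ∀ m j i n → S m (suc (suc j)) i (suc n) + (S m (suc j) i (suc n) + S m (suc j) i (suc n) + S m j i (suc n))
                     ≈ S m (suc j) (suc i) n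
  S-2+ m j i n = begin
    sum f₂ + (sum f₁ + sum f₁ + sum f₀)
      ≈⟨ +-congˡ (trans (∑-distrib-+ (λ l → f₁ l + f₁ l) f₀) (+-congʳ (∑-distrib-+ f₁ f₁))) ⟨
    sum f₂ + sum (λ l → f₁ l + f₁ l + f₀ l)
      ≈⟨ ∑-distrib-+ f₂ (λ l → f₁ l + f₁ l + f₀ l) ⟨
    g zero + sum (λ l → g (suc l))
      ≈⟨ +-cong (trans (factor zero) (trans (*-congˡ (x-y+y≈x 0# _)) (zeroʳ _)))
           (sum-cong (λ l → g (suc l)) (S-term m (suc j) (suc i) n) λ l → trans (factor (suc l))
             (*-cong (reflexive (≡.cong (μ m) (ℕ.+-suc i (toℕ l)))) (x-y+y≈x (u (suc j) (toℕ l)) _))) ⟩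
    0# + S m (suc j) (suc i) n
      ≈⟨ +-identityˡ _ ⟩
    S m (suc j) (suc i) n ∎
    where
    f₀ = S-term m j i (suc n)
    f₁ = S-term m (suc j) i (suc n)
    f₂ = S-term m (suc (suc j)) i (suc n)
    g : Vector Carrier (suc n)
    g l = f₂ l + (f₁ l + f₁ l + f₀ l)
    factor : ∀ l → g l ≈ μ m (i ℕ.+ toℕ l) * (u (suc (suc j)) (toℕ l)
                          + (u (suc j) (toℕ l) + u (suc j) (toℕ l) + u j (toℕ l)))
    factor l = solve 4 (λ x y z w → x :* y :+ (x :* z :+ x :* z :+ x :* w) := x :* (y :+ (z :+ z :+ w))) refl
      (μ m (i ℕ.+ toℕ l)) (u (suc (suc j)) (toℕ l)) (u (suc j) (toℕ l)) (u j (toℕ l))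

  -- The recurrence of q_j forces the values e k j = L_{-1-k}(q_j).
  module Extended
    (e : ℕ → ℕ → Carrier)
    (e-zero : ∀ k → e k 0 ≈ 0#)
    (e-one₀ : e 0 1 ≈ 1#)
    (e-one : ∀ k → e (suc k) 1 ≈ 0#)
    (e-rec₀ : ∀ j → e 0 (suc (suc j)) + (e 0 (suc j) + e 0 (suc j) + e 0 j) ≈ 0#)
    (e-rec : ∀ k j → e (suc k) (suc (suc j)) + (e (suc k) (suc j) + e (suc k) (suc j) + e (suc k) j) ≈ e k (suc j))
    where

    -- ψ w m j i is L_{i-m}(q_j) for i < m and L_{w+i-m}(q_j) for i ≥ m: the rows left
    -- after w expansions along row m.
    ψ : (w m j i : ℕ) → Carrier
    ψ w zero    j t       = F⁻ (j ℕ.+ (w ℕ.+ t)) (w ℕ.+ t) j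
    ψ w (suc m) j zero    = e m j
    ψ w (suc m) j (suc i) = ψ w m j i

    ψ-0 : ∀ m i → ψ 0 m 0 i ≈ μ m i
    ψ-0 zero    i       = refl
    ψ-0 (suc m) zero    = e-zero m
    ψ-0 (suc m) (suc i) = ψ-0 m i

    -- For nonnegative indices the b in q_1 = y - (1 + b) comes from `F-diagonal`, and the 1 from
    -- the Pascal rule next to the diagonal.
    ψ-1 : ∀ m i → ψ 0 m 1 i + (1# + b) * μ m i ≈ μ m (suc i)
    ψ-1 zero i = begin
      F⁻ (suc i) i 1 + (1# + b) * F i i
        ≈⟨ +-congˡ (trans (distribʳ _ _ _) (+-congʳ (*-identityˡ _))) ⟩
      F⁻ (suc i) i 1 + (F i i + b * F i i)
        ≈⟨ solve 3 (λ x y z → x :+ (y :+ z) := z :+ (y :+ x)) refl _ _ _ ⟩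
      b * F i i + (F i i + F⁻ (suc i) i 1)
        ≈⟨ +-cong (F-diagonal i) (F⁻-suc i i 0) ⟨
      F i (suc i) + F (suc i) i
        ≈⟨ F-suc i i ⟨
      F (suc i) (suc i) ∎
    ψ-1 (suc zero)    zero    = trans (+-cong e-one₀ (zeroʳ _)) (trans (+-identityʳ _) (sym (F-zero 0)))
    ψ-1 (suc (suc m)) zero    = trans (+-cong (e-one m) (zeroʳ _)) (+-identityʳ _)
    ψ-1 (suc m)       (suc i) = ψ-1 m i

    -- Two Pascal steps in the first index of `F⁻` produce the coefficients 1, 2, 1 of y q_{j+1} =
    -- q_{j+2} + 2 q_{j+1} + q_j.
    ψ-2+ : ∀ m j i → ψ 0 m (suc (suc j)) i + (ψ 0 m (suc j) i + ψ 0 m (suc j) i + ψ 0 m j i) ≈ ψ 0 m (suc j) (suc i)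
    ψ-2+ zero j t = sym (begin
      F⁻ (suc (j ℕ.+ suc t)) t j
        ≡⟨ ≡.cong (λ r → F⁻ (suc r) t j) (ℕ.+-suc j t) ⟩
      F⁻ (suc (suc r)) t j
        ≈⟨ F⁻-suc (suc r) t j ⟩
      F⁻ (suc r) t j + F⁻ (suc (suc r)) t (suc j)
        ≈⟨ +-cong (F⁻-suc r t j) (F⁻-suc (suc r) t (suc j)) ⟩
      (F⁻ r t j + F⁻ (suc r) t (suc j)) + (F⁻ (suc r) t (suc j) + F⁻ (suc (suc r)) t (suc (suc j)))
        ≈⟨ solve 3 (λ x y z → (x :+ y) :+ (y :+ z) := z :+ (y :+ y :+ x)) refl _ _ _ ⟩
      F⁻ (suc (suc r)) t (suc (suc j)) + (F⁻ (suc r) t (suc j) + F⁻ (suc r) t (suc j) + F⁻ r t j) ∎)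
      where r = j ℕ.+ t
    ψ-2+ (suc zero)    j zero    = trans (e-rec₀ j) (sym (F⁻-below (suc j ℕ.+ 0) 0 (suc j) (ℕ.s≤s ℕ.z≤n)))
    ψ-2+ (suc (suc m)) j zero    = e-rec m j
    ψ-2+ (suc m)       j (suc i) = ψ-2+ m j i

    -- Both sides obey the recurrence, which draws q_{j+2} in row i from q_{j+1} in row i + 1. So i
    -- stays free in the induction on j, and the cutoff falls together with j.
    S≈ψ : ∀ m j i n → j ℕ.< n → S m j i n ≈ ψ 0 m j i
    S≈ψ m zero          i (suc n)       _  = trans (S-0 m i n) (sym (ψ-0 m i))
    S≈ψ m (suc zero)    i (suc zero)    (ℕ.s≤s ())
    S≈ψ m (suc zero)    i (suc (suc n)) _  = +-cancelʳ ((1# + b) * μ m i) _ _ (trans (S-1 m i n) (sym (ψ-1 m i)))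
    S≈ψ m (suc (suc j)) i (suc n) (ℕ.s≤s j<n) = +-cancelʳ (ψ 0 m (suc j) i + ψ 0 m (suc j) i + ψ 0 m j i) _ _ (begin
      S m (suc (suc j)) i (suc n) + (ψ 0 m (suc j) i + ψ 0 m (suc j) i + ψ 0 m j i)
        ≈⟨ +-congˡ (+-cong (+-cong (S≈ψ m (suc j) i (suc n) (ℕ.m<n⇒m<1+n j<n)) (S≈ψ m (suc j) i (suc n) (ℕ.m<n⇒m<1+n j<n))) (S≈ψ m j i (suc n) (ℕ.m<n⇒m<1+n (ℕ.<⇒≤ j<n)))) ⟨
      S m (suc (suc j)) i (suc n) + (S m (suc j) i (suc n) + S m (suc j) i (suc n) + S m j i (suc n))
        ≈⟨ S-2+ m j i n ⟩
      S m (suc j) (suc i) n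
        ≈⟨ S≈ψ m (suc j) (suc i) n j<n ⟩
      ψ 0 m (suc j) (suc i)
        ≈⟨ ψ-2+ m j i ⟨
      ψ 0 m (suc (suc j)) i + (ψ 0 m (suc j) i + ψ 0 m (suc j) i + ψ 0 m j i) ∎)

    -- Removal of the unitriangular rows

    ψ-matrix : ∀ w m n → Matrix R n
    ψ-matrix w m n i j = ψ w m (w ℕ.+ toℕ j) (toℕ i)

    det-hankel-ψ : ∀ m n → det R (hankel m n) ≈ det R (ψ-matrix 0 m n)
    det-hankel-ψ m n = trans
      (sym (det-unitriangular (hankel m n) (λ l k → u (toℕ k) (toℕ l))
        (λ l k → u-above (toℕ k) (toℕ l)) (λ k → u-diagonal (toℕ k))))
      (det-cong (λ i k → S m (toℕ k) (toℕ i) n) (ψ-matrix 0 m n)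
        (λ i k → S≈ψ m (toℕ k) (toℕ i) n (toℕ<n k)))

    ψ-at : ∀ w m j → ψ w m j m ≡ ψ w 0 j 0
    ψ-at w zero    j = ≡.refl
    ψ-at w (suc m) j = ψ-at w m j

    ψ-above : ∀ w m j i → i ℕ.< m → ψ w m j i ≡ e (m ∸ suc i) j
    ψ-above w (suc m) j zero    i<m         = ≡.refl
    ψ-above w (suc m) j (suc i) (ℕ.s≤s i<m) = ψ-above w m j i i<m

    ψ-punchIn : ∀ {n} w (r : Fin (suc n)) j (i : Fin n) →
      ψ w (toℕ r) j (toℕ (punchIn r i)) ≡ ψ (suc w) (toℕ r) j (toℕ i)
    ψ-punchIn w zero    j i       = ≡.cong (λ t → F⁻ (j ℕ.+ t) t j) (ℕ.+-suc w (toℕ i))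
    ψ-punchIn w (suc r) j zero    = ≡.refl
    ψ-punchIn w (suc r) j (suc i) = ψ-punchIn w r j i

    -- Row m carries L_w on q_w, q_{w+1}, ..., that is 1, 0, 0, and so on; removing it with the
    -- first column leaves the same shape for w + 1. The shift m is given as `toℕ r` because it is
    -- also the index of this row.
    det-ψ-step : ∀ {n} w (r : Fin (suc n)) →
      det R (ψ-matrix w (toℕ r) (suc n)) ≈ (- 1#) ^ toℕ r * det R (ψ-matrix (suc w) (toℕ r) n)
    det-ψ-step {n} w r = trans
      (det-unit-row (ψ-matrix w (toℕ r) (suc n)) r
        (trans (reflexive (ψ-at w (toℕ r) (w ℕ.+ 0))) (F⁻-diagonal _ (w ℕ.+ 0)))
        (λ k → trans (reflexive (ψ-at w (toℕ r) (w ℕ.+ suc (toℕ k))))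
          (F⁻-below _ (w ℕ.+ 0) (w ℕ.+ suc (toℕ k)) (ℕ.+-monoʳ-< w (ℕ.s≤s ℕ.z≤n)))))
      (*-congˡ (det-cong (λ i k → ψ w (toℕ r) (w ℕ.+ suc (toℕ k)) (toℕ (punchIn r i))) (ψ-matrix (suc w) (toℕ r) n)
        (λ i k → reflexive (≡.trans (ψ-punchIn w r (w ℕ.+ suc (toℕ k)) i)
          (≡.cong (λ j → ψ (suc w) (toℕ r) j (toℕ i)) (ℕ.+-suc w (toℕ k)))))))

    det-ψ : ∀ m N w → det R (ψ-matrix w m (N ℕ.+ m)) ≈ ((- 1#) ^ m) ^ N * det R (ψ-matrix (N ℕ.+ w) m m)
    det-ψ m zero    w = sym (*-identityˡ _)
    det-ψ m (suc N) w = begin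
      det R (ψ-matrix w m (suc (N ℕ.+ m)))
        ≈⟨ ≡.subst (λ k → det R (ψ-matrix w k (suc (N ℕ.+ m))) ≈ (- 1#) ^ k * det R (ψ-matrix (suc w) k (N ℕ.+ m)))
             (toℕ-fromℕ< m<1+N+m) (det-ψ-step w (fromℕ< m<1+N+m)) ⟩
      (- 1#) ^ m * det R (ψ-matrix (suc w) m (N ℕ.+ m))
        ≈⟨ *-congˡ (det-ψ m N (suc w)) ⟩
      (- 1#) ^ m * (((- 1#) ^ m) ^ N * det R (ψ-matrix (N ℕ.+ suc w) m m))
        ≈⟨ *-assoc _ _ _ ⟨
      ((- 1#) ^ m) ^ suc N * det R (ψ-matrix (N ℕ.+ suc w) m m)
        ≡⟨ ≡.cong (λ v → ((- 1#) ^ m) ^ suc N * det R (ψ-matrix v m m)) (ℕ.+-suc N w) ⟩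
      ((- 1#) ^ m) ^ suc N * det R (ψ-matrix (suc N ℕ.+ w) m m) ∎
      where
      m<1+N+m : m ℕ.< suc (N ℕ.+ m)
      m<1+N+m = ℕ.s≤s (ℕ.m≤n+m m N)

    -- After N expansions the columns carry q_N, ..., q_{N+m-1}. The transposition puts the
    -- polynomial variable N + j on the rows; the degree index falls to 0 in the last column.
    D-block : ∀ m N → D R (ℤ.- (+ m)) b (N ℕ.+ m)
      ≈ ((- 1#) ^ m) ^ N * det R {m} (λ j i → e (m ∸ suc (toℕ i)) (N ℕ.+ toℕ j))
    D-block m N = begin
      D R (ℤ.- (+ m)) b (N ℕ.+ m)                        ≈⟨ D-hankel m (N ℕ.+ m) ⟩
      det R (hankel m (N ℕ.+ m))                         ≈⟨ det-hankel-ψ m (N ℕ.+ m) ⟩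
      det R (ψ-matrix 0 m (N ℕ.+ m))                     ≈⟨ det-ψ m N 0 ⟩
      ((- 1#) ^ m) ^ N * det R (ψ-matrix (N ℕ.+ 0) m m)  ≈⟨ *-congˡ (det-cong (ψ-matrix (N ℕ.+ 0) m m) (λ i j → E j i) λ i j →
        reflexive (≡.trans (ψ-above (N ℕ.+ 0) m _ (toℕ i) (toℕ<n i))
          (≡.cong (λ v → e (m ∸ suc (toℕ i)) (v ℕ.+ toℕ j)) (ℕ.+-identityʳ N)))) ⟩
      ((- 1#) ^ m) ^ N * det R (λ i j → E j i)           ≈⟨ *-congˡ (det-transpose E) ⟩
      ((- 1#) ^ m) ^ N * det R E                         ∎
      where
      E : Matrix R m
      E j i = e (m ∸ suc (toℕ i)) (N ℕ.+ toℕ j)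

-- Integer products and the entries of the block

module Integers where
  open import Data.Integer.Base using (_+_; _*_; _-_; -_; _^_)
  open +-*-Solver
  open ≡.≡-Reasoning
  open ≡ using (refl; sym; trans; cong; cong₂)

  sgn : ℕ → ℤ
  sgn n = -1ℤ ^ n

  sgn-+ : ∀ m n → sgn (m ℕ.+ n) ≡ sgn m * sgn n
  sgn-+ = ℤ.^-distribˡ-+-* -1ℤ

  sgn-square : ∀ n → sgn n * sgn n ≡ 1ℤ
  sgn-square zero    = refl
  sgn-square (suc n) = trans
    (solve 1 (λ s → (con -1ℤ :* s) :* (con -1ℤ :* s) := s :* s) refl (sgn n)) (sgn-square n)

  sgn-C₂ : ∀ m → sgn (suc (suc m) C 2) ≡ sgn (suc m) * sgn (suc m C 2)
  sgn-C₂ m = begin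
    sgn (suc (suc m) C 2)            ≡⟨ cong sgn (nCk+nC[k+1]≡[n+1]C[k+1] (suc m) 1) ⟨
    sgn (suc m C 1 ℕ.+ suc m C 2)    ≡⟨ cong (λ k → sgn (k ℕ.+ suc m C 2)) (nC1≡n (suc m)) ⟩
    sgn (suc m ℕ.+ suc m C 2)        ≡⟨ sgn-+ (suc m) (suc m C 2) ⟩
    sgn (suc m) * sgn (suc m C 2)    ∎

  -- Rising products and the numerators of p

  rise : ℤ → ℕ → ℤ
  rise z zero    = 1ℤ
  rise z (suc n) = z * rise (z + 1ℤ) n

  rise-snoc : ∀ z n → rise z (suc n) ≡ rise z n * (z + + n)
  rise-snoc z zero    = solve 1 (λ z → z :* con 1ℤ := con 1ℤ :* (z :+ con 0ℤ)) refl z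
  rise-snoc z (suc n) = begin
    z * rise (z + 1ℤ) (suc n)                ≡⟨ cong (z *_) (rise-snoc (z + 1ℤ) n) ⟩
    z * (rise (z + 1ℤ) n * (z + 1ℤ + + n))   ≡⟨ solve 3 (λ z r n → z :* (r :* (z :+ con 1ℤ :+ n)) := (z :* r) :* (z :+ (con 1ℤ :+ n))) refl z _ (+ n) ⟩
    rise z (suc n) * (z + + suc n)           ∎

  rise-reflect : ∀ z n → rise (1ℤ - z - + n) n ≡ sgn n * rise z n
  rise-reflect z zero    = refl
  rise-reflect z (suc n) = begin
    (1ℤ - z - + suc n) * rise (1ℤ - z - + suc n + 1ℤ) n
      ≡⟨ cong₂ (λ x y → x * rise y n)
           (solve 2 (λ z n → con 1ℤ :- z :- (con 1ℤ :+ n) := :- (z :+ n)) refl z (+ n))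
           (solve 2 (λ z n → con 1ℤ :- z :- (con 1ℤ :+ n) :+ con 1ℤ := con 1ℤ :- z :- n) refl z (+ n)) ⟩
    - (z + + n) * rise (1ℤ - z - + n) n
      ≡⟨ cong (- (z + + n) *_) (rise-reflect z n) ⟩
    - (z + + n) * (sgn n * rise z n)
      ≡⟨ solve 4 (λ z n s r → :- (z :+ n) :* (s :* r) := (con -1ℤ :* s) :* (r :* (z :+ n))) refl z (+ n) (sgn n) (rise z n) ⟩
    sgn (suc n) * (rise z n * (z + + n))
      ≡⟨ cong (sgn (suc n) *_) (rise-snoc z n) ⟨
    sgn (suc n) * rise z (suc n) ∎

  -- num m y = ∏_{1≤i≤j≤m} (y + i + j); the recursion splits off i = 1.
  num : ℕ → ℤ → ℤ
  num zero    y = 1ℤ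
  num (suc m) y = num m (y + + 2) * rise (y + + 2) (suc m)

  -- Splitting off j = m + 1 instead.
  num-last : ∀ m y → num (suc m) y ≡ num m y * rise (y + + 2 + + m) (suc m)
  num-last zero    y = cong (λ z → 1ℤ * rise z 1) (sym (ℤ.+-identityʳ (y + + 2)))
  num-last (suc m) y = begin
    num (suc m) z * rise z (suc (suc m))
      ≡⟨ cong₂ _*_ (num-last m z) (rise-snoc z (suc m)) ⟩
    (num m z * rise (z + + 2 + + m) (suc m)) * (rise z (suc m) * (z + + suc m))
      ≡⟨ cong (λ x → (num m z * rise x (suc m)) * (rise z (suc m) * (z + + suc m)))
           (solve 2 (λ z m → z :+ con (+ 2) :+ m := z :+ (con 1ℤ :+ m) :+ con 1ℤ) refl z (+ m)) ⟩
    (num m z * rise (z + + suc m + 1ℤ) (suc m)) * (rise z (suc m) * (z + + suc m))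
      ≡⟨ solve 4 (λ a b c d → (a :* b) :* (c :* d) := (a :* c) :* (d :* b)) refl
           (num m z) (rise (z + + suc m + 1ℤ) (suc m)) (rise z (suc m)) (z + + suc m) ⟩
    num (suc m) y * rise (z + + suc m) (suc (suc m)) ∎
    where z = y + + 2

  -- The factor at (i, j) becomes minus the factor at (m + 1 - j, m + 1 - i), and there are C(m + 1,
  -- 2) factors. In the induction those with i = 1 on one side meet those with the largest j on the
  -- other.
  num-reflect : ∀ m y → num m (- y - + 2 * + suc m) ≡ sgn (suc m C 2) * num m y
  num-reflect zero    y = refl
  num-reflect (suc m) y = begin
    num m (w + + 2) * rise (w + + 2) (suc m)
      ≡⟨ cong₂ (λ u v → num m u * rise v (suc m))
           (solve 2 (λ y m → :- y :- con (+ 2) :* (con (+ 2) :+ m) :+ con (+ 2) := :- y :- con (+ 2) :* (con 1ℤ :+ m)) refl y (+ m))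
           (solve 2 (λ y m → :- y :- con (+ 2) :* (con (+ 2) :+ m) :+ con (+ 2)
                       := con 1ℤ :- (y :+ con (+ 2) :+ m) :- (con 1ℤ :+ m)) refl y (+ m)) ⟩
    num m (- y - + 2 * + suc m) * rise (1ℤ - z - + suc m) (suc m)
      ≡⟨ cong₂ _*_ (num-reflect m y) (rise-reflect z (suc m)) ⟩
    (sgn (suc m C 2) * num m y) * (sgn (suc m) * rise z (suc m))
      ≡⟨ solve 4 (λ a b c d → (a :* b) :* (c :* d) := (c :* a) :* (b :* d)) refl
           (sgn (suc m C 2)) (num m y) (sgn (suc m)) (rise z (suc m)) ⟩
    (sgn (suc m) * sgn (suc m C 2)) * (num m y * rise z (suc m))
      ≡⟨ cong₂ _*_ (sgn-C₂ m) (num-last m y) ⟨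
    sgn (suc (suc m) C 2) * num (suc m) y ∎
    where
    w = - y - + 2 * + suc (suc m)
    z = y + + 2 + + m

  -- The factor with i = j = n is zero; n - 1 shifts of y by 2 bring it to the front.
  num-vanishes : ∀ m n → 1 ℕ.≤ n → n ℕ.≤ m → num m (+ 2 * - + n) ≡ 0ℤ
  num-vanishes (suc m) (suc zero)    _ _             = ℤ.*-zeroʳ (num m 0ℤ)
  num-vanishes (suc m) (suc (suc n)) _ (ℕ.s≤s n<m) = begin
    num m (y + + 2) * r             ≡⟨ cong (λ x → num m x * r)
      (solve 1 (λ n → con (+ 2) :* (:- (con (+ 2) :+ n)) :+ con (+ 2) := con (+ 2) :* (:- (con 1ℤ :+ n))) refl (+ n)) ⟩
    num m (+ 2 * - + suc n) * r     ≡⟨ cong (_* r) (num-vanishes m (suc n) (ℕ.s≤s ℕ.z≤n) n<m) ⟩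
    0ℤ                              ∎
    where
    y = + 2 * - + suc (suc n)
    r = rise (y + + 2) (suc m)

  -- Binomial identities for the entries of the block

  absorption : ∀ n r → suc r ℕ.* (suc n C suc r) ≡ suc n ℕ.* (n C r)
  absorption n       zero    = trans (ℕ.+-identityʳ _) (trans (nC1≡n (suc n)) (sym (ℕ.*-identityʳ (suc n))))
  absorption zero    (suc r) = trans
    (cong (suc (suc r) ℕ.*_) (k>n⇒nCk≡0 {1} {suc (suc r)} (ℕ.s≤s (ℕ.s≤s ℕ.z≤n)))) (ℕ.*-zeroʳ (suc (suc r)))
  absorption (suc n) (suc r) = begin
    suc (suc r) ℕ.* (suc (suc n) C suc (suc r))
      ≡⟨ cong (suc (suc r) ℕ.*_) (nCk+nC[k+1]≡[n+1]C[k+1] (suc n) (suc r)) ⟨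
    suc (suc r) ℕ.* (c ℕ.+ suc n C suc (suc r))
      ≡⟨ ℕ.*-distribˡ-+ (suc (suc r)) c _ ⟩
    (c ℕ.+ suc r ℕ.* c) ℕ.+ suc (suc r) ℕ.* (suc n C suc (suc r))
      ≡⟨ cong₂ (λ x y → (c ℕ.+ x) ℕ.+ y) (absorption n r) (absorption n (suc r)) ⟩
    (c ℕ.+ suc n ℕ.* (n C r)) ℕ.+ suc n ℕ.* (n C suc r)
      ≡⟨ ℕ.+-assoc c _ _ ⟩
    c ℕ.+ (suc n ℕ.* (n C r) ℕ.+ suc n ℕ.* (n C suc r))
      ≡⟨ cong (c ℕ.+_) (ℕ.*-distribˡ-+ (suc n) (n C r) _) ⟨
    c ℕ.+ suc n ℕ.* (n C r ℕ.+ n C suc r)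
      ≡⟨ cong (λ x → c ℕ.+ suc n ℕ.* x) (nCk+nC[k+1]≡[n+1]C[k+1] n r) ⟩
    suc (suc n) ℕ.* c ∎
    where c = suc n C suc r

  absorptionℤ : ∀ n r → + suc r * + (suc n C suc r) ≡ + suc n * + (n C r)
  absorptionℤ n r = trans (sym (ℤ.pos-* (suc r) (suc n C suc r)))
    (trans (cong +_ (absorption n r)) (ℤ.pos-* (suc n) (n C r)))

  C-sucʳ : ∀ n r → + suc r * + (n C suc r) ≡ (+ n - + r) * + (n C r)
  C-sucʳ n r = begin
    + suc r * x                        ≡⟨ solve 3 (λ a x y → a :* x := a :* (y :+ x) :- a :* y) refl (+ suc r) x y ⟩
    + suc r * (y + x) - + suc r * y    ≡⟨ cong (λ c → + suc r * + c - + suc r * y) (nCk+nC[k+1]≡[n+1]C[k+1] n r) ⟩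
    + suc r * + (suc n C suc r) - + suc r * y ≡⟨ cong (_- + suc r * y) (absorptionℤ n r) ⟩
    + suc n * y - + suc r * y          ≡⟨ solve 3 (λ n r y → (con 1ℤ :+ n) :* y :- (con 1ℤ :+ r) :* y := (n :- r) :* y) refl (+ n) (+ r) y ⟩
    (+ n - + r) * y                    ∎
    where
    x = + (n C suc r)
    y = + (n C r)

  -- The values L_{-1-k}(q_j).
  e : ℕ → ℕ → ℤ
  e k j = sgn (suc (j ℕ.+ k)) * + ((j ℕ.+ k) C suc (k ℕ.+ k))

  e-below : ∀ k j → j ℕ.≤ k → e k j ≡ 0ℤ
  e-below k j j≤k = trans (cong (λ c → sgn (suc (j ℕ.+ k)) * + c) (k>n⇒nCk≡0 (ℕ.s≤s (ℕ.+-monoˡ-≤ k j≤k))))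
    (ℤ.*-zeroʳ (sgn (suc (j ℕ.+ k))))

  e-0 : ∀ j → e 0 j ≡ sgn (suc j) * + j
  e-0 j = trans (cong (λ i → sgn (suc i) * + (i C 1)) (ℕ.+-identityʳ j)) (cong (λ c → sgn (suc j) * + c) (nC1≡n j))

  e-rec₀ : ∀ j → e 0 (suc (suc j)) + (e 0 (suc j) + e 0 (suc j) + e 0 j) ≡ 0ℤ
  e-rec₀ j = begin
    e 0 (suc (suc j)) + (e 0 (suc j) + e 0 (suc j) + e 0 j)
      ≡⟨ cong₂ (λ x y → x + y) (e-0 (suc (suc j))) (cong₂ (λ x y → x + x + y) (e-0 (suc j)) (e-0 j)) ⟩
    sgn (suc (suc (suc j))) * + suc (suc j) + (sgn (suc (suc j)) * + suc j + sgn (suc (suc j)) * + suc j + sgn (suc j) * + j)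
      ≡⟨ solve 2 (λ s j → (con -1ℤ :* (con -1ℤ :* s)) :* (con (+ 2) :+ j) :+ ((con -1ℤ :* s) :* (con 1ℤ :+ j) :+ (con -1ℤ :* s) :* (con 1ℤ :+ j) :+ s :* j) := con 0ℤ) refl (sgn (suc j)) (+ j) ⟩
    0ℤ ∎

  -- The second difference of C(n, r) in n is C(n, r - 2); the alternating sign of `e` turns the
  -- middle coefficient -2 into 2.
  e-rec : ∀ k j → e (suc k) (suc (suc j)) + (e (suc k) (suc j) + e (suc k) (suc j) + e (suc k) j) ≡ e k (suc j)
  e-rec k j = begin
    (-1ℤ * (-1ℤ * s)) * + (suc (suc n) C r) + ((-1ℤ * s) * + (suc n C r) + (-1ℤ * s) * + (suc n C r) + s * + (n C r))
      ≡⟨ cong₂ (λ x y → (-1ℤ * (-1ℤ * s)) * + x + ((-1ℤ * s) * + y + (-1ℤ * s) * + y + s * + (n C r))) second first ⟩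
    (-1ℤ * (-1ℤ * s)) * (a + b + (b + c)) + ((-1ℤ * s) * (b + c) + (-1ℤ * s) * (b + c) + s * c)
      ≡⟨ solve 4 (λ s a b c → (con -1ℤ :* (con -1ℤ :* s)) :* (a :+ b :+ (b :+ c))
            :+ ((con -1ℤ :* s) :* (b :+ c) :+ (con -1ℤ :* s) :* (b :+ c) :+ s :* c) := s :* a) refl s a b c ⟩
    s * a
      ≡⟨ cong (λ i → sgn (suc i) * + (i C suc (k ℕ.+ k))) (ℕ.+-suc j k) ⟩
    e k (suc j) ∎
    where
    n = j ℕ.+ suc k
    q = k ℕ.+ k
    r = suc (suc k ℕ.+ suc k)
    r≡ : r ≡ suc (suc (suc q))
    r≡ = cong (λ i → suc (suc i)) (ℕ.+-suc k k)
    s = sgn (suc n)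
    a = + (n C suc q)
    b = + (n C suc (suc q))
    c = + (n C r)
    first : suc n C r ≡ n C suc (suc q) ℕ.+ n C r
    first = trans (cong (suc n C_) r≡) (trans (sym (nCk+nC[k+1]≡[n+1]C[k+1] n (suc (suc q))))
      (cong (λ i → n C suc (suc q) ℕ.+ n C i) (sym r≡)))
    second : suc (suc n) C r ≡ (n C suc q ℕ.+ n C suc (suc q)) ℕ.+ (n C suc (suc q) ℕ.+ n C r)
    second = trans (cong (suc (suc n) C_) r≡) (trans (sym (nCk+nC[k+1]≡[n+1]C[k+1] (suc n) (suc (suc q))))
      (cong₂ ℕ._+_ (sym (nCk+nC[k+1]≡[n+1]C[k+1] n (suc q))) (trans (cong (suc n C_) (sym r≡)) first)))

  -- The quotient of (2k + 3)! by (2k + 1)!.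
  a : ℕ → ℤ
  a k = + 2 * + suc k * (+ 2 * + suc k + 1ℤ)

  -- C(j + k + 1, 2k + 3) is C(j + k, 2k + 1) times (j + k + 1)(j - k - 1) / ((2k + 2)(2k + 3)).
  -- Iterated, this shows that up to the sign (-1)^(j+1) the entry is j times a polynomial of degree
  -- k in j^2.
  e-suc : ∀ k j → a k * e (suc k) j ≡ (+ suc k * + suc k - + j * + j) * e k j
  e-suc k j = begin
    a k * (sgn (suc (j ℕ.+ suc k)) * + ((j ℕ.+ suc k) C suc (suc k ℕ.+ suc k)))
      ≡⟨ cong₂ (λ x y → a k * (sgn (suc x) * + (x C suc (suc y)))) (ℕ.+-suc j k) (ℕ.+-suc k k) ⟩
    a k * ((-1ℤ * s) * + (suc n C suc (suc r)))
      ≡⟨ solve 3 (λ k s c → con (+ 2) :* (con 1ℤ :+ k) :* (con (+ 2) :* (con 1ℤ :+ k) :+ con 1ℤ) :* ((con -1ℤ :* s) :* c)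
            := (:- s) :* ((con (+ 2) :+ (k :+ k)) :* ((con (+ 3) :+ (k :+ k)) :* c))) refl
           (+ k) s (+ (suc n C suc (suc r))) ⟩
    - s * (+ suc r * (+ suc (suc r) * + (suc n C suc (suc r))))
      ≡⟨ cong (λ x → - s * (+ suc r * x)) (absorptionℤ n (suc r)) ⟩
    - s * (+ suc r * (+ suc n * + (n C suc r)))
      ≡⟨ solve 4 (λ s r n c → (:- s) :* (r :* (n :* c)) := (:- s) :* (n :* (r :* c))) refl
           s (+ suc r) (+ suc n) (+ (n C suc r)) ⟩
    - s * (+ suc n * (+ suc r * + (n C suc r)))
      ≡⟨ cong (λ x → - s * (+ suc n * x)) (C-sucʳ n r) ⟩
    - s * (+ suc n * ((+ n - + r) * + (n C r)))
      ≡⟨ solve 4 (λ s j k c → (:- s) :* ((con 1ℤ :+ (j :+ k)) :* (((j :+ k) :- (con 1ℤ :+ (k :+ k))) :* c))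
            := ((con 1ℤ :+ k) :* (con 1ℤ :+ k) :- j :* j) :* (s :* c)) refl
           s (+ j) (+ k) (+ (n C r)) ⟩
    (+ suc k * + suc k - + j * + j) * (s * + (n C r)) ∎
    where
    n = j ℕ.+ k
    r = suc (k ℕ.+ k)
    s = sgn (suc n)

  ∏a : ℕ → ℤ
  ∏a zero    = 1ℤ
  ∏a (suc m) = a m * ∏a m

  -- Both sides are 2 (2m + 1)!, as `∏a m` is (2m + 1)!. The factor 2 will turn the N of `e 0 N`
  -- into 2N.
  rise-∏a : ∀ m → rise 1ℤ m * rise (+ 2 + + m) (suc m) ≡ + 2 * ∏a m
  rise-∏a zero    = refl
  rise-∏a (suc m) = begin
    rise 1ℤ (suc m) * rise z (suc (suc m))
      ≡⟨ cong₂ _*_ (rise-snoc 1ℤ m) (trans (rise-snoc z (suc m)) (cong (_* (z + + suc m)) (rise-snoc z m))) ⟩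
    (rise 1ℤ m * (1ℤ + + m)) * (rise z m * (z + + m) * (z + + suc m))
      ≡⟨ solve 3 (λ f r m → (f :* (con 1ℤ :+ m)) :* (r :* (con (+ 3) :+ m :+ m) :* (con (+ 3) :+ m :+ (con 1ℤ :+ m)))
            := con (+ 2) :* (con 1ℤ :+ m) :* (con (+ 2) :* (con 1ℤ :+ m) :+ con 1ℤ) :* (f :* ((con (+ 2) :+ m) :* r))) refl
           (rise 1ℤ m) (rise z m) (+ m) ⟩
    a m * (rise 1ℤ m * ((+ 2 + + m) * rise z m))
      ≡⟨ cong (λ x → a m * (rise 1ℤ m * ((+ 2 + + m) * rise x m)))
           (solve 1 (λ m → con (+ 3) :+ m := con (+ 2) :+ m :+ con 1ℤ) refl (+ m)) ⟩
    a m * (rise 1ℤ m * rise (+ 2 + + m) (suc m))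
      ≡⟨ cong (a m *_) (rise-∏a m) ⟩
    a m * (+ 2 * ∏a m)
      ≡⟨ solve 2 (λ a p → a :* (con (+ 2) :* p) := con (+ 2) :* (a :* p)) refl (a m) (∏a m) ⟩
    + 2 * ∏a (suc m) ∎
    where z = + 2 + + suc m

-- Transport of determinants along a ring homomorphism

module Homomorphism {c ℓ c′ ℓ′} (K : CommutativeRing c ℓ) (R : CommutativeRing c′ ℓ′)
  (ι : CommutativeRing.Carrier K → CommutativeRing.Carrier R)
  (ι-hom : IsRingHomomorphism (CommutativeRing.rawRing K) (CommutativeRing.rawRing R) ι) where
  private module K = CommutativeRing K
  open CommutativeRing R hiding (zero)
  open IsRingHomomorphism ι-hom
  open SemiringExp semiring using (_^_)
  open SemiringExp K.semiring using () renaming (_^_ to _^ᴷ_)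
  open SemiringSum semiring using (sum)
  open SemiringSum K.semiring using () renaming (sum to sumᴷ)
  open Determinant R using (rowTerm; sum-cong)
  open Determinant K using () renaming (rowTerm to rowTermᴷ)

  sum-homo : ∀ {n} (f : Vector K.Carrier n) → ι (sumᴷ f) ≈ sum (ι ∘ f)
  sum-homo {zero}  f = 0#-homo
  sum-homo {suc n} f = trans (+-homo _ _) (+-congˡ (sum-homo (f ∘ suc)))

  sign-homo : ∀ n → ι ((K.- K.1#) ^ᴷ n) ≈ (- 1#) ^ n
  sign-homo zero    = 1#-homo
  sign-homo (suc n) = trans (*-homo _ _)
    (*-cong (trans (-‿homo K.1#) (-‿cong 1#-homo)) (sign-homo n))

  det-homo : ∀ {n} (A : Matrix K n) → ι (det K A) ≈ det R (λ i j → ι (A i j))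
  det-homo {zero}  A = 1#-homo
  det-homo {suc n} A = trans (sum-homo (rowTermᴷ A))
    (sum-cong (ι ∘ rowTermᴷ A) (rowTerm (λ i j → ι (A i j))) λ j →
      trans (*-homo _ _)
        (*-cong (trans (*-homo _ _) (*-congʳ (sign-homo (toℕ j)))) (det-homo (λ i k → A (suc i) (punchIn j k)))))

-- Evaluation of the block

module Rationals where
  open Integers
  open ≡.≡-Reasoning
  open ≡ using (refl; sym; trans; cong; cong₂)
  open RawSemiringDefinitions ℚ.+-*-rawSemiring using (product)
  open Determinant ℚ.+-*-commutativeRing
  open CommutativeMonoidSum ℚ.*-1-commutativeMonoid using () renaming (sum-cong-≗ to product-cong; ∑-distrib-+ to product-*)
  open SemiringExp (CommutativeRing.semiring ℚ.+-*-commutativeRing) using () renaming (_^_ to _^ℚ_)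
  module ℤS = +-*-Solver
  module ℚS = SemiringSolver (CommutativeRing.commutativeSemiring ℚ.+-*-commutativeRing)

  J : ℤ → ℚ
  J i = i ℚ./ 1

  toℚᵘ-J : ∀ i → ℚ.toℚᵘ (J i) ℚᵘ.≃ ℚᵘ.mkℚᵘ i 0
  toℚᵘ-J i = ℚ.toℚᵘ-fromℚᵘ (ℚᵘ.mkℚᵘ i 0)

  -- Checked on unnormalised representatives with denominator 1, so that no greatest common divisor
  -- intervenes.
  J-+ : ∀ i j → J (i ℤ.+ j) ≡ J i ℚ.+ J j
  J-+ i j = ℚ.toℚᵘ-injective (ℚᵘ.≃-trans (toℚᵘ-J (i ℤ.+ j)) (ℚᵘ.≃-trans
    (ℚᵘ.*≡* (ℤS.solve 2 (λ i j → (i ℤS.:+ j) ℤS.:* ℤS.con 1ℤ ℤS.:= (i ℤS.:* ℤS.con 1ℤ ℤS.:+ j ℤS.:* ℤS.con 1ℤ) ℤS.:* ℤS.con 1ℤ) refl i j))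
    (ℚᵘ.≃-sym (ℚᵘ.≃-trans (ℚ.toℚᵘ-homo-+ (J i) (J j)) (ℚᵘ.+-cong (toℚᵘ-J i) (toℚᵘ-J j))))))

  J-* : ∀ i j → J (i ℤ.* j) ≡ J i ℚ.* J j
  J-* i j = ℚ.toℚᵘ-injective (ℚᵘ.≃-trans (toℚᵘ-J (i ℤ.* j)) (ℚᵘ.≃-trans
    (ℚᵘ.*≡* refl)
    (ℚᵘ.≃-sym (ℚᵘ.≃-trans (ℚ.toℚᵘ-homo-* (J i) (J j)) (ℚᵘ.*-cong (toℚᵘ-J i) (toℚᵘ-J j))))))

  J-inverse : ∀ s .{{_ : NonZero s}} → J (+ s) ℚ.* (+ 1 ℚ./ s) ≡ 1ℚ
  J-inverse (suc s) = ℚ.toℚᵘ-injective (ℚᵘ.≃-trans (ℚ.toℚᵘ-homo-* (J (+ suc s)) (+ 1 ℚ./ suc s))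
    (ℚᵘ.≃-trans (ℚᵘ.*-cong (toℚᵘ-J (+ suc s)) (ℚ.toℚᵘ-fromℚᵘ (ℚᵘ.mkℚᵘ (+ 1) s)))
      (ℚᵘ.*≡* (ℤS.solve 1 (λ s → (s ℤS.:* ℤS.con 1ℤ) ℤS.:* ℤS.con 1ℤ ℤS.:= ℤS.con 1ℤ ℤS.:* (ℤS.con 1ℤ ℤS.:* s)) refl (+ suc s)))))

  sgn-J : ∀ n → (ℚ.- 1ℚ) ^ℚ n ≡ J (sgn n)
  sgn-J zero    = refl
  sgn-J (suc n) = trans (cong (J -1ℤ ℚ.*_) (sgn-J n)) (sym (J-* -1ℤ (sgn n)))

  -- The value of `a k` in a form that is visibly nonzero, as a denominator must be.
  aℕ : ℕ → ℕ
  aℕ k = suc (suc (k ℕ.+ k)) ℕ.* suc (suc (suc (k ℕ.+ k)))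

  a≡aℕ : ∀ k → a k ≡ + aℕ k
  a≡aℕ k = trans
    (ℤS.solve 1 (λ k → ℤS.con (+ 2) ℤS.:* (ℤS.con 1ℤ ℤS.:+ k) ℤS.:* (ℤS.con (+ 2) ℤS.:* (ℤS.con 1ℤ ℤS.:+ k) ℤS.:+ ℤS.con 1ℤ)
      ℤS.:= (ℤS.con (+ 2) ℤS.:+ (k ℤS.:+ k)) ℤS.:* (ℤS.con (+ 3) ℤS.:+ (k ℤS.:+ k))) refl (+ k))
    (sym (ℤ.pos-* (suc (suc (k ℕ.+ k))) (suc (suc (suc (k ℕ.+ k))))))

  α : ℕ → ℚ
  α k = + 1 ℚ./ aℕ k

  a*α : ∀ k → J (a k) ℚ.* α k ≡ 1ℚ
  a*α k = trans (cong (λ i → J i ℚ.* α k) (a≡aℕ k)) (J-inverse (aℕ k))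

  E : ℕ → ℕ → ℚ
  E k j = J (e k j)

  E-suc : ∀ k j → E (suc k) j ≡ α k ℚ.* (J (+ suc k ℤ.* + suc k ℤ.- + j ℤ.* + j) ℚ.* E k j)
  E-suc k j = begin
    E (suc k) j                                 ≡⟨ ℚ.*-identityˡ _ ⟨
    1ℚ ℚ.* E (suc k) j                          ≡⟨ cong (ℚ._* E (suc k) j) (a*α k) ⟨
    J (a k) ℚ.* α k ℚ.* E (suc k) j             ≡⟨ ℚS.solve 3 (λ x y z → x ℚS.:* y ℚS.:* z ℚS.:= y ℚS.:* (x ℚS.:* z)) refl (J (a k)) (α k) (E (suc k) j) ⟩
    α k ℚ.* (J (a k) ℚ.* E (suc k) j)           ≡⟨ cong (α k ℚ.*_) (J-* (a k) (e (suc k) j)) ⟨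
    α k ℚ.* J (a k ℤ.* e (suc k) j)             ≡⟨ cong (λ i → α k ℚ.* J i) (e-suc k j) ⟩
    α k ℚ.* J (q ℤ.* e k j)                     ≡⟨ cong (α k ℚ.*_) (J-* q (e k j)) ⟩
    α k ℚ.* (J q ℚ.* E k j)                     ∎
    where q = + suc k ℤ.* + suc k ℤ.- + j ℤ.* + j

  -- Elimination in the block

  W-matrix : ∀ m → ℕ → Matrix ℚ.+-*-commutativeRing m
  W-matrix m N j i = E (m ∸ suc (toℕ i)) (N ℕ.+ toℕ j)

  W : ℕ → ℕ → ℚ
  W m N = det ℚ.+-*-commutativeRing (W-matrix m N)

  β : ℕ → ℕ → ℚ
  β N j = J (+ N ℤ.* + N ℤ.- + (N ℕ.+ j) ℤ.* + (N ℕ.+ j))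

  β-zero : ∀ N → β N 0 ≡ 0ℚ
  β-zero N = cong J (trans (cong (λ n → + N ℤ.* + N ℤ.- + n ℤ.* + n) (ℕ.+-identityʳ N)) (ℤ.+-inverseʳ (+ N ℤ.* + N)))

  ∏α : ℕ → ℚ
  ∏α m = product {m} (λ i → α (m ∸ suc (toℕ i)))

  ∏a*∏α : ∀ m → J (∏a m) ℚ.* ∏α m ≡ 1ℚ
  ∏a*∏α zero    = refl
  ∏a*∏α (suc m) = begin
    J (a m ℤ.* ∏a m) ℚ.* (α m ℚ.* ∏α m)         ≡⟨ cong (ℚ._* (α m ℚ.* ∏α m)) (J-* (a m) (∏a m)) ⟩
    J (a m) ℚ.* J (∏a m) ℚ.* (α m ℚ.* ∏α m)     ≡⟨ ℚS.solve 4 (λ x y z w → x ℚS.:* y ℚS.:* (z ℚS.:* w) ℚS.:= x ℚS.:* z ℚS.:* (y ℚS.:* w)) refl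
                                                     (J (a m)) (J (∏a m)) (α m) (∏α m) ⟩
    J (a m) ℚ.* α m ℚ.* (J (∏a m) ℚ.* ∏α m)     ≡⟨ cong₂ ℚ._*_ (a*α m) (∏a*∏α m) ⟩
    1ℚ                                          ∎

  -- Subtracting from the column of degree k + 1 the multiple of its right neighbour that
  -- kills row 0 leaves the factors (N² - (N + j)²) / a k times the column of degree k.
  W-suc : ∀ m N → W (suc m) N ≡
    ((ℚ.- 1ℚ) ^ℚ m ℚ.* E 0 (N ℕ.+ 0)) ℚ.* (product {m} (λ j → β N (suc (toℕ j))) ℚ.* (∏α m ℚ.* W m (suc N)))
  W-suc m N = begin
    W (suc m) N
      ≡⟨ det-add-next (W-matrix (suc m) N) B (λ i → x (m ∸ suc (toℕ i))) B-inject₁ B-last ⟨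
    det ℚ.+-*-commutativeRing B
      ≡⟨ det-expand-last B B-zero ⟩
    ((ℚ.- 1ℚ) ^ℚ m ℚ.* B zero (fromℕ m)) ℚ.* det ℚ.+-*-commutativeRing (λ j i → B (suc j) (inject₁ i))
      ≡⟨ cong₂ (λ y z → ((ℚ.- 1ℚ) ^ℚ m ℚ.* y) ℚ.* z) (B-last zero)
           (trans (det-cong (λ j i → B (suc j) (inject₁ i)) (λ j i → β N (suc (toℕ j)) ℚ.* C j i) minor)
           (trans (det-scale-rows (λ j → β N (suc (toℕ j))) C)
             (cong (product {m} (λ j → β N (suc (toℕ j))) ℚ.*_) (det-scale-columns (λ i → α (m ∸ suc (toℕ i))) (W-matrix m (suc N)))))) ⟩
    ((ℚ.- 1ℚ) ^ℚ m ℚ.* W-matrix (suc m) N zero (fromℕ m)) ℚ.* rest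
      ≡⟨ cong (λ k → ((ℚ.- 1ℚ) ^ℚ m ℚ.* E k (N ℕ.+ 0)) ℚ.* rest) m∸m ⟩
    ((ℚ.- 1ℚ) ^ℚ m ℚ.* E 0 (N ℕ.+ 0)) ℚ.* rest ∎
    where
    rest = product {m} (λ j → β N (suc (toℕ j))) ℚ.* (∏α m ℚ.* W m (suc N))
    -- As E (k + 1) n = α k ((k + 1)^2 - n^2) E k n, adding this multiple of E k n replaces (k +
    -- 1)^2 by N^2, and the entry at n = N vanishes.
    x : ℕ → ℚ
    x k = α k ℚ.* J (+ N ℤ.* + N ℤ.- + suc k ℤ.* + suc k)
    column : ℕ → ℕ → ℚ
    column zero    j = E 0 (N ℕ.+ j)
    column (suc k) j = β N j ℚ.* (α k ℚ.* E k (N ℕ.+ j))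
    B : Matrix ℚ.+-*-commutativeRing (suc m)
    B j i = column (m ∸ toℕ i) (toℕ j)
    C : Matrix ℚ.+-*-commutativeRing m
    C j i = α (m ∸ suc (toℕ i)) ℚ.* W-matrix m (suc N) j i
    m∸m : m ∸ toℕ (fromℕ m) ≡ 0
    m∸m = trans (cong (m ∸_) (toℕ-fromℕ m)) (ℕ.n∸n≡0 m)
    m∸inject₁ : ∀ (i : Fin m) → m ∸ toℕ (inject₁ i) ≡ suc (m ∸ suc (toℕ i))
    m∸inject₁ i = trans (cong (m ∸_) (toℕ-inject₁ i)) (ℕ.+-∸-assoc 1 (toℕ<n i))
    column-suc : ∀ k j → column (suc k) j ≡ E (suc k) (N ℕ.+ j) ℚ.+ x k ℚ.* E k (N ℕ.+ j)
    column-suc k j = begin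
      β N j ℚ.* (α k ℚ.* E k n)
        ≡⟨ cong (λ i → J i ℚ.* (α k ℚ.* E k n)) (ℤS.solve 3 (λ N k n → N ℤS.:- n ℤS.:= (k ℤS.:- n) ℤS.:+ (N ℤS.:- k)) refl
             (+ N ℤ.* + N) (+ suc k ℤ.* + suc k) (+ n ℤ.* + n)) ⟩
      J (q ℤ.+ r) ℚ.* (α k ℚ.* E k n)
        ≡⟨ cong (ℚ._* (α k ℚ.* E k n)) (J-+ q r) ⟩
      (J q ℚ.+ J r) ℚ.* (α k ℚ.* E k n)
        ≡⟨ ℚS.solve 4 (λ q r a e → (q ℚS.:+ r) ℚS.:* (a ℚS.:* e) ℚS.:= a ℚS.:* (q ℚS.:* e) ℚS.:+ a ℚS.:* r ℚS.:* e) refl (J q) (J r) (α k) (E k n) ⟩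
      α k ℚ.* (J q ℚ.* E k n) ℚ.+ x k ℚ.* E k n
        ≡⟨ cong (ℚ._+ x k ℚ.* E k n) (E-suc k n) ⟨
      E (suc k) n ℚ.+ x k ℚ.* E k n ∎
      where
      n = N ℕ.+ j
      q = + suc k ℤ.* + suc k ℤ.- + n ℤ.* + n
      r = + N ℤ.* + N ℤ.- + suc k ℤ.* + suc k
    B-inject₁ : ∀ j i → B j (inject₁ i) ≡ W-matrix (suc m) N j (inject₁ i) ℚ.+ x (m ∸ suc (toℕ i)) ℚ.* W-matrix (suc m) N j (suc i)
    B-inject₁ j i = begin
      column (m ∸ toℕ (inject₁ i)) (toℕ j)     ≡⟨ cong (λ k → column k (toℕ j)) (m∸inject₁ i) ⟩
      column (suc k) (toℕ j)                   ≡⟨ column-suc k (toℕ j) ⟩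
      E (suc k) n ℚ.+ x k ℚ.* E k n            ≡⟨ cong (λ k′ → E k′ n ℚ.+ x k ℚ.* E k n) (m∸inject₁ i) ⟨
      E (m ∸ toℕ (inject₁ i)) n ℚ.+ x k ℚ.* E k n ∎
      where
      k = m ∸ suc (toℕ i)
      n = N ℕ.+ toℕ j
    B-last : ∀ j → B j (fromℕ m) ≡ W-matrix (suc m) N j (fromℕ m)
    B-last j = trans (cong (λ k → column k (toℕ j)) m∸m) (cong (λ k → E k (N ℕ.+ toℕ j)) (sym m∸m))
    B-zero : ∀ i → B zero (inject₁ i) ≡ 0ℚ
    B-zero i = trans (cong (λ k → column k 0) (m∸inject₁ i)) (trans (cong (ℚ._* y) (β-zero N)) (ℚ.*-zeroˡ y))
      where y = α (m ∸ suc (toℕ i)) ℚ.* E (m ∸ suc (toℕ i)) (N ℕ.+ 0)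
    minor : ∀ j i → B (suc j) (inject₁ i) ≡ β N (suc (toℕ j)) ℚ.* C j i
    minor j i = trans (cong (λ k → column k (suc (toℕ j))) (m∸inject₁ i))
      (cong (λ n → β N (suc (toℕ j)) ℚ.* (α k ℚ.* E k n)) (ℕ.+-suc N (toℕ j)))
      where k = m ∸ suc (toℕ i)

  product-rise : ∀ m s z → product {m} (λ j → J (ℤ.- ((s ℤ.+ + toℕ j) ℤ.* (z ℤ.+ + toℕ j)))) ≡ J (sgn m ℤ.* (rise s m ℤ.* rise z m))
  product-rise zero    s z = refl
  product-rise (suc m) s z = begin
    J (ℤ.- ((s ℤ.+ 0ℤ) ℤ.* (z ℤ.+ 0ℤ))) ℚ.* product {m} (λ j → J (ℤ.- ((s ℤ.+ + suc (toℕ j)) ℤ.* (z ℤ.+ + suc (toℕ j)))))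
      ≡⟨ cong₂ ℚ._*_ (cong₂ (λ x y → J (ℤ.- (x ℤ.* y))) (ℤ.+-identityʳ s) (ℤ.+-identityʳ z))
           (trans (product-cong (λ (j : Fin m) → cong₂ (λ x y → J (ℤ.- (x ℤ.* y))) (sym (ℤ.+-assoc s 1ℤ (+ toℕ j))) (sym (ℤ.+-assoc z 1ℤ (+ toℕ j)))))
                  (product-rise m (s ℤ.+ 1ℤ) (z ℤ.+ 1ℤ))) ⟩
    J (ℤ.- (s ℤ.* z)) ℚ.* J (sgn m ℤ.* (rs ℤ.* rz))
      ≡⟨ J-* (ℤ.- (s ℤ.* z)) (sgn m ℤ.* (rs ℤ.* rz)) ⟨
    J (ℤ.- (s ℤ.* z) ℤ.* (sgn m ℤ.* (rs ℤ.* rz)))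
      ≡⟨ cong J (ℤS.solve 5 (λ s z g a b → (ℤS.:- (s ℤS.:* z)) ℤS.:* (g ℤS.:* (a ℤS.:* b)) ℤS.:= (ℤS.con -1ℤ ℤS.:* g) ℤS.:* ((s ℤS.:* a) ℤS.:* (z ℤS.:* b))) refl
           s z (sgn m) rs rz) ⟩
    J (sgn (suc m) ℤ.* (rise s (suc m) ℤ.* rise z (suc m))) ∎
    where
    rs = rise (s ℤ.+ 1ℤ) m
    rz = rise (z ℤ.+ 1ℤ) m

  -- N^2 - (N + 1 + j)^2 = -(1 + j)(2N + 1 + j).
  product-β : ∀ m N → product {m} (λ j → β N (suc (toℕ j))) ≡ J (sgn m ℤ.* (rise 1ℤ m ℤ.* rise (+ (N ℕ.+ N) ℤ.+ 1ℤ) m))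
  product-β m N = trans
    (product-cong (λ (j : Fin m) → cong J (ℤS.solve 2 (λ N j → N ℤS.:* N ℤS.:- (N ℤS.:+ (ℤS.con 1ℤ ℤS.:+ j)) ℤS.:* (N ℤS.:+ (ℤS.con 1ℤ ℤS.:+ j))
      ℤS.:= ℤS.:- ((ℤS.con 1ℤ ℤS.:+ j) ℤS.:* (N ℤS.:+ N ℤS.:+ ℤS.con 1ℤ ℤS.:+ j))) refl (+ N) (+ toℕ j))))
    (product-rise m 1ℤ (+ (N ℕ.+ N) ℤ.+ 1ℤ))

  -- The product of the signs of `e 0 N`, `e 0 (N + 1)`, ..., one for each elimination step.
  σ : ℕ → ℕ → ℤ
  σ zero    N = 1ℤ
  σ (suc m) N = sgn (suc N) ℤ.* σ m (suc N)

  σ≡ : ∀ m N → σ m N ≡ sgn (m ℕ.* N) ℤ.* sgn (suc m C 2)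
  σ≡ zero    N = refl
  σ≡ (suc m) N = begin
    sgn (suc N) ℤ.* σ m (suc N)
      ≡⟨ cong (sgn (suc N) ℤ.*_) (σ≡ m (suc N)) ⟩
    sgn (suc N) ℤ.* (sgn (m ℕ.* suc N) ℤ.* t)
      ≡⟨ cong (λ k → sgn (suc N) ℤ.* (sgn k ℤ.* t)) (ℕ.*-suc m N) ⟩
    sgn (suc N) ℤ.* (sgn (m ℕ.+ m ℕ.* N) ℤ.* t)
      ≡⟨ cong (λ s → sgn (suc N) ℤ.* (s ℤ.* t)) (sgn-+ m (m ℕ.* N)) ⟩
    sgn (suc N) ℤ.* (sgn m ℤ.* sgn (m ℕ.* N) ℤ.* t)
      ≡⟨ ℤS.solve 4 (λ a b c t → (ℤS.con -1ℤ ℤS.:* a) ℤS.:* (b ℤS.:* c ℤS.:* t) ℤS.:= (a ℤS.:* c) ℤS.:* ((ℤS.con -1ℤ ℤS.:* b) ℤS.:* t)) refl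
           (sgn N) (sgn m) (sgn (m ℕ.* N)) t ⟩
    (sgn N ℤ.* sgn (m ℕ.* N)) ℤ.* (sgn (suc m) ℤ.* t)
      ≡⟨ cong₂ ℤ._*_ (sgn-+ N (m ℕ.* N)) (sgn-C₂ m) ⟨
    sgn (suc m ℕ.* N) ℤ.* sgn (suc (suc m) C 2) ∎
    where t = sgn (suc m C 2)

  -- Multiplying by the denominator `num m 0ℤ` of p turns the claim into a recursion of products.
  -- One elimination step contributes 2N (2N + 1) ... (2N + m), which are the factors with i = 1 in
  -- `num (suc m)` at 2N - 2.
  W-num : ∀ m N → W m N ℚ.* J (num m 0ℤ) ≡ J (σ m N ℤ.* num m (+ (N ℕ.+ N) ℤ.- + 2))
  W-num zero    N = refl
  W-num (suc m) N = begin
    W (suc m) N ℚ.* J (num (suc m) 0ℤ)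
      ≡⟨ cong₂ ℚ._*_ (W-suc m N) (cong J (num-last m 0ℤ)) ⟩
    ((ℚ.- 1ℚ) ^ℚ m ℚ.* E 0 (N ℕ.+ 0)) ℚ.* (product {m} (λ j → β N (suc (toℕ j))) ℚ.* (∏α m ℚ.* W m (suc N))) ℚ.* J (num m 0ℤ ℤ.* r)
      ≡⟨ cong₂ ℚ._*_ (cong₂ ℚ._*_ (cong₂ ℚ._*_ (sgn-J m) (cong J (trans (cong (e 0) (ℕ.+-identityʳ N)) (e-0 N))))
           (cong (ℚ._* (∏α m ℚ.* W m (suc N))) (product-β m N))) (J-* (num m 0ℤ) r) ⟩
    (J (sgn m) ℚ.* J s) ℚ.* (J q ℚ.* (∏α m ℚ.* W m (suc N))) ℚ.* (J (num m 0ℤ) ℚ.* J r)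
      ≡⟨ ℚS.solve 7 (λ g s q a w n r → (g ℚS.:* s) ℚS.:* (q ℚS.:* (a ℚS.:* w)) ℚS.:* (n ℚS.:* r) ℚS.:= g ℚS.:* s ℚS.:* q ℚS.:* r ℚS.:* a ℚS.:* (w ℚS.:* n)) refl
           (J (sgn m)) (J s) (J q) (∏α m) (W m (suc N)) (J (num m 0ℤ)) (J r) ⟩
    J (sgn m) ℚ.* J s ℚ.* J q ℚ.* J r ℚ.* ∏α m ℚ.* (W m (suc N) ℚ.* J (num m 0ℤ))
      ≡⟨ cong₂ (λ x y → x ℚ.* ∏α m ℚ.* y) coefficient (W-num m (suc N)) ⟩
    J t ℚ.* J (∏a m) ℚ.* ∏α m ℚ.* J (σ m (suc N) ℤ.* num m z′)
      ≡⟨ cong (ℚ._* J (σ m (suc N) ℤ.* num m z′)) (trans (ℚ.*-assoc (J t) (J (∏a m)) (∏α m))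
           (trans (cong (J t ℚ.*_) (∏a*∏α m)) (ℚ.*-identityʳ (J t)))) ⟩
    J t ℚ.* J (σ m (suc N) ℤ.* num m z′)
      ≡⟨ J-* t (σ m (suc N) ℤ.* num m z′) ⟨
    J (t ℤ.* (σ m (suc N) ℤ.* num m z′))
      ≡⟨ cong J (begin
        t ℤ.* (σ m (suc N) ℤ.* num m z′)
          ≡⟨ cong (λ y → t ℤ.* (σ m (suc N) ℤ.* num m y)) (ℤS.solve 1 (λ N → (ℤS.con 1ℤ ℤS.:+ N ℤS.:+ (ℤS.con 1ℤ ℤS.:+ N)) ℤS.:- ℤS.con (+ 2) ℤS.:= N ℤS.:+ N) refl (+ N)) ⟩
        t ℤ.* (σ m (suc N) ℤ.* num m z)
          ≡⟨ ℤS.solve 5 (λ g z r s n → (g ℤS.:* (z ℤS.:* r)) ℤS.:* (s ℤS.:* n) ℤS.:= (g ℤS.:* s) ℤS.:* (n ℤS.:* (z ℤS.:* r))) refl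
               (sgn (suc N)) z (rise (z ℤ.+ 1ℤ) m) (σ m (suc N)) (num m z) ⟩
        σ (suc m) N ℤ.* (num m z ℤ.* rise z (suc m))
          ≡⟨ cong (λ y → σ (suc m) N ℤ.* (num m y ℤ.* rise y (suc m))) (ℤS.solve 1 (λ z → z ℤS.:= z ℤS.:- ℤS.con (+ 2) ℤS.:+ ℤS.con (+ 2)) refl z) ⟩
        σ (suc m) N ℤ.* num (suc m) (z ℤ.- + 2) ∎) ⟩
    J (σ (suc m) N ℤ.* num (suc m) (z ℤ.- + 2)) ∎
    where
    z  = + (N ℕ.+ N)
    z′ = + (suc N ℕ.+ suc N) ℤ.- + 2
    r  = rise (+ 2 ℤ.+ + m) (suc m)
    s  = sgn (suc N) ℤ.* + N
    q  = sgn m ℤ.* (rise 1ℤ m ℤ.* rise (z ℤ.+ 1ℤ) m)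
    t  = sgn (suc N) ℤ.* (z ℤ.* rise (z ℤ.+ 1ℤ) m)
    coefficient : J (sgn m) ℚ.* J s ℚ.* J q ℚ.* J r ≡ J t ℚ.* J (∏a m)
    coefficient = begin
      J (sgn m) ℚ.* J s ℚ.* J q ℚ.* J r
        ≡⟨ trans (J-* (sgn m ℤ.* s ℤ.* q) r) (cong (ℚ._* J r) (trans (J-* (sgn m ℤ.* s) q) (cong (ℚ._* J q) (J-* (sgn m) s)))) ⟨
      J (sgn m ℤ.* s ℤ.* q ℤ.* r)
        ≡⟨ cong J (begin
          sgn m ℤ.* s ℤ.* q ℤ.* r
            ≡⟨ ℤS.solve 6 (λ g h N f y r → g ℤS.:* (h ℤS.:* N) ℤS.:* (g ℤS.:* (f ℤS.:* y)) ℤS.:* r ℤS.:= (g ℤS.:* g) ℤS.:* (h ℤS.:* N ℤS.:* y ℤS.:* (f ℤS.:* r))) refl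
                 (sgn m) (sgn (suc N)) (+ N) (rise 1ℤ m) (rise (z ℤ.+ 1ℤ) m) r ⟩
          (sgn m ℤ.* sgn m) ℤ.* (s ℤ.* rise (z ℤ.+ 1ℤ) m ℤ.* (rise 1ℤ m ℤ.* r))
            -- The sign of the expansion along the first row and the signs of the factors `β` are
            -- both `sgn m` and cancel.
            ≡⟨ cong₂ (λ x y → x ℤ.* (s ℤ.* rise (z ℤ.+ 1ℤ) m ℤ.* y)) (sgn-square m) (rise-∏a m) ⟩
          1ℤ ℤ.* (s ℤ.* rise (z ℤ.+ 1ℤ) m ℤ.* (+ 2 ℤ.* ∏a m))
            ≡⟨ ℤS.solve 4 (λ h N y a → ℤS.con 1ℤ ℤS.:* (h ℤS.:* N ℤS.:* y ℤS.:* (ℤS.con (+ 2) ℤS.:* a)) ℤS.:= (h ℤS.:* ((N ℤS.:+ N) ℤS.:* y)) ℤS.:* a) refl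
                 (sgn (suc N)) (+ N) (rise (z ℤ.+ 1ℤ) m) (∏a m) ⟩
          t ℤ.* ∏a m ∎) ⟩
      J (t ℤ.* ∏a m)
        ≡⟨ J-* t (∏a m) ⟩
      J t ℚ.* J (∏a m) ∎

  -- The polynomial p as a quotient of integer products

  numerators : ℕ → ℤ → ℚ
  numerators m y = product {m} λ j → product {suc (toℕ j)} λ i → J (y ℤ.+ + (suc (toℕ i) ℕ.+ suc (toℕ j)))

  reciprocals : ℕ → ℚ
  reciprocals m = product {m} λ j → product {suc (toℕ j)} λ i → + 1 ℚ./ (suc (toℕ i) ℕ.+ suc (toℕ j))

  product-shifts : ∀ n y z s → y ℤ.+ + suc s ≡ z → product {n} (λ j → J (y ℤ.+ + suc (s ℕ.+ toℕ j))) ≡ J (rise z n)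
  product-shifts zero    y z s eq = refl
  product-shifts (suc n) y z s eq = begin
    J (y ℤ.+ + suc (s ℕ.+ 0)) ℚ.* product {n} (λ j → J (y ℤ.+ + suc (s ℕ.+ suc (toℕ j))))
      ≡⟨ cong₂ ℚ._*_ (cong J (trans (cong (λ k → y ℤ.+ + suc k) (ℕ.+-identityʳ s)) eq))
           (trans (product-cong (λ (j : Fin n) → cong (λ k → J (y ℤ.+ + suc k)) (ℕ.+-suc s (toℕ j))))
                  (product-shifts n y (z ℤ.+ 1ℤ) (suc s) (trans
                    (ℤS.solve 2 (λ y s → y ℤS.:+ (ℤS.con (+ 2) ℤS.:+ s) ℤS.:= y ℤS.:+ (ℤS.con 1ℤ ℤS.:+ s) ℤS.:+ ℤS.con 1ℤ) refl y (+ s))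
                    (cong (ℤ._+ 1ℤ) eq)))) ⟩
    J z ℚ.* J (rise (z ℤ.+ 1ℤ) n)
      ≡⟨ J-* z (rise (z ℤ.+ 1ℤ) n) ⟨
    J (rise z (suc n)) ∎

  -- The factor with i = 1 is split off each inner product; lowering both indices by one then adds 2
  -- to y, as in the recursion of `num`.
  numerators-num : ∀ m y → numerators m y ≡ J (num m y)
  numerators-num zero    y = refl
  numerators-num (suc m) y = begin
    product {suc m} (λ j → f j ℚ.* g j)
      ≡⟨ product-* f g ⟩
    -- The factor 1 is the inner product at j = 1, which is empty once i = 1 is split off.
    product f ℚ.* (1ℚ ℚ.* product {m} (λ j → g (suc j)))
      ≡⟨ cong₂ ℚ._*_ (product-shifts (suc m) y (y ℤ.+ + 2) 1 refl) (trans (ℚ.*-identityˡ (product {m} (λ j → g (suc j))))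
           (trans (product-cong (λ (j : Fin m) → product-cong (λ (i : Fin (suc (toℕ j))) → cong J (shift (toℕ i) (toℕ j))))) (numerators-num m (y ℤ.+ + 2)))) ⟩
    J (rise (y ℤ.+ + 2) (suc m)) ℚ.* J (num m (y ℤ.+ + 2))
      ≡⟨ trans (J-* (num m (y ℤ.+ + 2)) (rise (y ℤ.+ + 2) (suc m))) (ℚ.*-comm (J (num m (y ℤ.+ + 2))) (J (rise (y ℤ.+ + 2) (suc m)))) ⟨
    J (num (suc m) y) ∎
    where
    f g : Vector ℚ (suc m)
    f j = J (y ℤ.+ + suc (suc (toℕ j)))
    g j = product {toℕ j} λ i → J (y ℤ.+ + (suc (suc (toℕ i)) ℕ.+ suc (toℕ j)))
    shift : ∀ i j → y ℤ.+ + (suc (suc i) ℕ.+ suc (suc j)) ≡ y ℤ.+ + 2 ℤ.+ + (suc i ℕ.+ suc j)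
    shift i j = ℤS.solve 3 (λ y i j → y ℤS.:+ (ℤS.con (+ 2) ℤS.:+ i ℤS.:+ (ℤS.con (+ 2) ℤS.:+ j))
      ℤS.:= y ℤS.:+ ℤS.con (+ 2) ℤS.:+ (ℤS.con 1ℤ ℤS.:+ i ℤS.:+ (ℤS.con 1ℤ ℤS.:+ j))) refl y (+ i) (+ j)

  numerators*reciprocals : ∀ m y → (product {m} λ j → product {suc (toℕ j)} λ i →
      J (y ℤ.+ + (suc (toℕ i) ℕ.+ suc (toℕ j))) ℚ.* (+ 1 ℚ./ (suc (toℕ i) ℕ.+ suc (toℕ j)))) ≡ J (num m y) ℚ.* reciprocals m
  numerators*reciprocals m y = begin
    (product {m} λ j → product {suc (toℕ j)} λ i → f j i ℚ.* g j i)
      ≡⟨ product-cong (λ (j : Fin m) → product-* (f j) (g j)) ⟩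
    (product {m} λ j → product {suc (toℕ j)} (f j) ℚ.* product {suc (toℕ j)} (g j))
      ≡⟨ product-* {m} (λ j → product {suc (toℕ j)} (f j)) (λ j → product {suc (toℕ j)} (g j)) ⟩
    numerators m y ℚ.* reciprocals m
      ≡⟨ cong (ℚ._* reciprocals m) (numerators-num m y) ⟩
    J (num m y) ℚ.* reciprocals m ∎
    where
    f g : (j : Fin m) → Vector ℚ (suc (toℕ j))
    f j i = J (y ℤ.+ + (suc (toℕ i) ℕ.+ suc (toℕ j)))
    g j i = + 1 ℚ./ (suc (toℕ i) ℕ.+ suc (toℕ j))

  product-one : ∀ n (f : Vector ℚ n) → (∀ i → f i ≡ 1ℚ) → product f ≡ 1ℚ
  product-one zero    f f≡1 = refl
  product-one (suc n) f f≡1 = cong₂ ℚ._*_ (f≡1 zero) (product-one n (f ∘ suc) (f≡1 ∘ suc))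

  num₀*reciprocals : ∀ m → J (num m 0ℤ) ℚ.* reciprocals m ≡ 1ℚ
  num₀*reciprocals m = trans (sym (numerators*reciprocals m 0ℤ)) (product-one m _ λ j → product-one (suc (toℕ j)) _ λ i →
    J-inverse (suc (toℕ i) ℕ.+ suc (toℕ j)))

  p-num : ∀ m i → p (suc m) (J i) ≡ J (num m (+ 2 ℤ.* i)) ℚ.* reciprocals m
  p-num m i = trans
    (product-cong (λ (j′ : Fin m) → product-cong (λ (i′ : Fin (suc (toℕ j′))) →
      cong (ℚ._* (+ 1 ℚ./ (suc (toℕ i′) ℕ.+ suc (toℕ j′))))
        (trans (cong (ℚ._+ J (+ (suc (toℕ i′) ℕ.+ suc (toℕ j′)))) (sym (J-* (+ 2) i)))
               (sym (J-+ (+ 2 ℤ.* i) (+ (suc (toℕ i′) ℕ.+ suc (toℕ j′)))))))))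
    (numerators*reciprocals m (+ 2 ℤ.* i))

  W-p : ∀ m N → W m (suc N) ≡ J (σ m (suc N)) ℚ.* p (suc m) (J (+ N))
  W-p m N = begin
    W m (suc N)
      ≡⟨ ℚ.*-identityʳ (W m (suc N)) ⟨
    W m (suc N) ℚ.* 1ℚ
      ≡⟨ cong (W m (suc N) ℚ.*_) (num₀*reciprocals m) ⟨
    W m (suc N) ℚ.* (J (num m 0ℤ) ℚ.* reciprocals m)
      ≡⟨ ℚ.*-assoc (W m (suc N)) (J (num m 0ℤ)) (reciprocals m) ⟨
    W m (suc N) ℚ.* J (num m 0ℤ) ℚ.* reciprocals m
      ≡⟨ cong (ℚ._* reciprocals m) (W-num m (suc N)) ⟩
    J (σ m (suc N) ℤ.* num m (+ (suc N ℕ.+ suc N) ℤ.- + 2)) ℚ.* reciprocals m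
      ≡⟨ cong (λ y → J (σ m (suc N) ℤ.* num m y) ℚ.* reciprocals m)
           (ℤS.solve 1 (λ N → (ℤS.con 1ℤ ℤS.:+ N ℤS.:+ (ℤS.con 1ℤ ℤS.:+ N)) ℤS.:- ℤS.con (+ 2) ℤS.:= ℤS.con (+ 2) ℤS.:* N) refl (+ N)) ⟩
    J (σ m (suc N) ℤ.* num m (+ 2 ℤ.* + N)) ℚ.* reciprocals m
      ≡⟨ cong (ℚ._* reciprocals m) (J-* (σ m (suc N)) (num m (+ 2 ℤ.* + N))) ⟩
    J (σ m (suc N)) ℚ.* J (num m (+ 2 ℤ.* + N)) ℚ.* reciprocals m
      ≡⟨ ℚ.*-assoc (J (σ m (suc N))) (J (num m (+ 2 ℤ.* + N))) (reciprocals m) ⟩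
    J (σ m (suc N)) ℚ.* (J (num m (+ 2 ℤ.* + N)) ℚ.* reciprocals m)
      ≡⟨ cong (J (σ m (suc N)) ℚ.*_) (p-num m (+ N)) ⟨
    J (σ m (suc N)) ℚ.* p (suc m) (J (+ N)) ∎

  p-at-0 : ∀ m → p (suc m) (J 0ℤ) ≡ 1ℚ
  p-at-0 m = trans (p-num m 0ℤ) (num₀*reciprocals m)

  p-vanishes : ∀ m n → 1 ≤ n → n ≤ m → p (suc m) (J (ℤ.- + n)) ≡ 0ℚ
  p-vanishes m n 1≤n n≤m = trans (p-num m (ℤ.- + n))
    (trans (cong (λ i → J i ℚ.* reciprocals m) (num-vanishes m n 1≤n n≤m)) (ℚ.*-zeroˡ (reciprocals m)))

  -- Twice the argument -(N + m + 1) is -2N - 2(m + 1), the reflection of y = 2N in `num-reflect`.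
  p-reflect : ∀ m N → p (suc m) (J (ℤ.- + (suc N ℕ.+ m))) ≡ J (sgn (suc m C 2)) ℚ.* p (suc m) (J (+ N))
  p-reflect m N = begin
    p (suc m) (J (ℤ.- + (suc N ℕ.+ m)))
      ≡⟨ p-num m (ℤ.- + (suc N ℕ.+ m)) ⟩
    J (num m (+ 2 ℤ.* ℤ.- + (suc N ℕ.+ m))) ℚ.* reciprocals m
      ≡⟨ cong (λ i → J i ℚ.* reciprocals m) (trans (cong (num m)
           (ℤS.solve 2 (λ N m → ℤS.con (+ 2) ℤS.:* (ℤS.:- (ℤS.con 1ℤ ℤS.:+ N ℤS.:+ m)) ℤS.:= ℤS.:- (ℤS.con (+ 2) ℤS.:* N) ℤS.:- ℤS.con (+ 2) ℤS.:* (ℤS.con 1ℤ ℤS.:+ m)) refl (+ N) (+ m)))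
           (num-reflect m (+ 2 ℤ.* + N))) ⟩
    J (sgn (suc m C 2) ℤ.* num m (+ 2 ℤ.* + N)) ℚ.* reciprocals m
      ≡⟨ cong (ℚ._* reciprocals m) (J-* (sgn (suc m C 2)) (num m (+ 2 ℤ.* + N))) ⟩
    J (sgn (suc m C 2)) ℚ.* J (num m (+ 2 ℤ.* + N)) ℚ.* reciprocals m
      ≡⟨ ℚ.*-assoc (J (sgn (suc m C 2))) (J (num m (+ 2 ℤ.* + N))) (reciprocals m) ⟩
    J (sgn (suc m C 2)) ℚ.* (J (num m (+ 2 ℤ.* + N)) ℚ.* reciprocals m)
      ≡⟨ cong (J (sgn (suc m C 2)) ℚ.*_) (p-num m (+ N)) ⟨
    J (sgn (suc m C 2)) ℚ.* p (suc m) (J (+ N)) ∎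

-- The value of the determinant over R

module Specialisation {c ℓ} (R : CommutativeRing c ℓ) (ι : ℚ → CommutativeRing.Carrier R)
  (ι-hom : IsRingHomomorphism ℚ.+-*-rawRing (CommutativeRing.rawRing R) ι)
  (b : CommutativeRing.Carrier R) where
  open CommutativeRing R hiding (zero)
  open IsRingHomomorphism ι-hom
  open SemiringExp semiring using (_^_; ^-assocʳ)
  open SetoidReasoning setoid
  open Integers
  open Rationals
  open Homomorphism ℚ.+-*-commutativeRing R ι ι-hom using (det-homo; sign-homo)
  open Moments R b using (D-vanishes; module Extended)

  φ : ℤ → Carrier
  φ i = ι (J i)

  φ-+ : ∀ i j → φ (i ℤ.+ j) ≈ φ i + φ j
  φ-+ i j = trans (⟦⟧-cong (J-+ i j)) (+-homo (J i) (J j))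

  φ-sgn : ∀ n → φ (sgn n) ≈ (- 1#) ^ n
  φ-sgn n = trans (⟦⟧-cong (≡.sym (sgn-J n))) (sign-homo n)

  φ-recurrence : ∀ x y z {w} → x ℤ.+ (y ℤ.+ y ℤ.+ z) ≡ w → φ x + (φ y + φ y + φ z) ≈ φ w
  φ-recurrence x y z eq = trans
    (sym (trans (φ-+ x (y ℤ.+ y ℤ.+ z)) (+-congˡ (trans (φ-+ (y ℤ.+ y) z) (+-congʳ (φ-+ y y))))))
    (⟦⟧-cong (≡.cong J eq))

  open Extended (λ k j → φ (e k j))
    (λ k → trans (⟦⟧-cong (≡.cong J (e-below k 0 ℕ.z≤n))) 0#-homo)
    -- `e 0 1` computes to 1.
    1#-homo
    (λ k → trans (⟦⟧-cong (≡.cong J (e-below (suc k) 1 (ℕ.s≤s ℕ.z≤n)))) 0#-homo)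
    (λ j → trans (φ-recurrence (e 0 (suc (suc j))) (e 0 (suc j)) (e 0 j) (e-rec₀ j)) 0#-homo)
    (λ k j → φ-recurrence (e (suc k) (suc (suc j))) (e (suc k) (suc j)) (e (suc k) j) (e-rec k j))
    using (D-block)

  -- The sign (-1)^(m (N + 1)) of the row expansions cancels against the same factor of
  -- `σ m (suc N)`, and (-1)^C(m + 1, 2) survives.
  D-value : ∀ m N → D R (ℤ.- (+ m)) b (suc N ℕ.+ m) ≈ ι (J (sgn (suc m C 2)) ℚ.* p (suc m) (J (+ N)))
  D-value m N = begin
    D R (ℤ.- (+ m)) b (suc N ℕ.+ m)
      ≈⟨ D-block m (suc N) ⟩
    ((- 1#) ^ m) ^ suc N * det R {m} (λ j i → φ (e (m ∸ suc (toℕ i)) (suc N ℕ.+ toℕ j)))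
      ≈⟨ *-cong (trans (^-assocʳ (- 1#) m (suc N)) (sym (φ-sgn k))) (sym (det-homo (W-matrix m (suc N)))) ⟩
    φ (sgn k) * ι (W m (suc N))
      ≈⟨ *-homo (J (sgn k)) (W m (suc N)) ⟨
    ι (J (sgn k) ℚ.* W m (suc N))
      ≈⟨ ⟦⟧-cong sign ⟩
    ι (J t ℚ.* P) ∎
    where
    k = m ℕ.* suc N
    t = sgn (suc m C 2)
    P = p (suc m) (J (+ N))
    sign : J (sgn k) ℚ.* W m (suc N) ≡ J t ℚ.* P
    sign = ≡.trans (≡.cong (J (sgn k) ℚ.*_) (W-p m N))
      (≡.trans (≡.sym (ℚ.*-assoc (J (sgn k)) (J (σ m (suc N))) P))
      (≡.cong (ℚ._* P) (≡.trans (≡.sym (J-* (sgn k) (σ m (suc N)))) (≡.cong J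
        (≡.trans (≡.cong (sgn k ℤ.*_) (σ≡ m (suc N)))
        (≡.trans (≡.sym (ℤ.*-assoc (sgn k) (sgn k) t))
        (≡.trans (≡.cong (ℤ._* t) (sgn-square k)) (ℤ.*-identityˡ t))))))))

  -- At n = 0 the empty determinant meets p_{m+1}(0) = 1, for 1 ≤ n ≤ m both sides are zero, and
  -- beyond m the sign in `D-value` is that of the reflection of p.
  D-reflected : ∀ m n → D R (ℤ.- (+ m)) b n ≈ ι (p (suc m) (J (ℤ.- + n)))
  D-reflected m zero = sym (trans (⟦⟧-cong (p-at-0 m)) 1#-homo)
  D-reflected m n@(suc _) with n ℕ.≤? m
  ... | yes n≤m = trans (D-vanishes m n (ℕ.s≤s ℕ.z≤n) n≤m)
    (sym (trans (⟦⟧-cong (p-vanishes m n (ℕ.s≤s ℕ.z≤n) n≤m)) 0#-homo))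
  ... | no n≰m with ℕ.m≤n⇒∃[o]m+o≡n (ℕ.≰⇒> n≰m)
  ...   | N , ≡.refl = ≡.subst (λ k → D R (ℤ.- (+ m)) b (suc k) ≈ ι (p (suc m) (J (ℤ.- + suc k)))) (ℕ.+-comm N m)
    (trans (D-value m N) (⟦⟧-cong (≡.sym (p-reflect m N))))

  D-large : ∀ m n → suc m ≤ n →
    D R (ℤ.- (+ m)) b n ≈ (- 1#) ^ (suc m C 2) * ι (p (suc m) (J (+ n ℤ.- + m ℤ.- + 1)))
  D-large m n m<n with ℕ.m≤n⇒∃[o]m+o≡n m<n
  ... | N , ≡.refl = begin
    D R (ℤ.- (+ m)) b (suc (m ℕ.+ N))
      ≡⟨ ≡.cong (λ k → D R (ℤ.- (+ m)) b (suc k)) (ℕ.+-comm m N) ⟩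
    D R (ℤ.- (+ m)) b (suc N ℕ.+ m)
      ≈⟨ D-value m N ⟩
    ι (J (sgn (suc m C 2)) ℚ.* p (suc m) (J (+ N)))
      ≈⟨ *-homo (J (sgn (suc m C 2))) (p (suc m) (J (+ N))) ⟩
    φ (sgn (suc m C 2)) * ι (p (suc m) (J (+ N)))
      ≈⟨ *-cong (φ-sgn (suc m C 2)) (reflexive (≡.cong (λ i → ι (p (suc m) (J i)))
           (ℤS.solve 2 (λ m N → N ℤS.:= (ℤS.con 1ℤ ℤS.:+ (m ℤS.:+ N)) ℤS.:- m ℤS.:- ℤS.con 1ℤ) ≡.refl (+ m) (+ N)))) ⟩
    (- 1#) ^ (suc m C 2) * ι (p (suc m) (J (+ suc (m ℕ.+ N) ℤ.- + m ℤ.- + 1))) ∎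

theorem6 : ∀ {c ℓ} (R : CommutativeRing c ℓ) →
    let open CommutativeRing R
        open SemiringExp semiring using (_^_)
    in (ι : ℚ → Carrier) → IsRingHomomorphism ℚ.+-*-rawRing rawRing ι →
    (b : Carrier) (m : ℕ) → 1 ≤ m →
    (∀ n → D R (ℤ.- (+ m)) b n ≈ ι (p (suc m) (ℤ.- (+ n) ℚ./ 1)))
    × (∀ n → 1 ≤ n → n ≤ m → D R (ℤ.- (+ m)) b n ≈ 0#)
    × (∀ n → suc m ≤ n →
        D R (ℤ.- (+ m)) b n
          ≈ ((- 1#) ^ (suc m C 2)) * ι (p (suc m) ((+ n ℤ.- + m ℤ.- + 1) ℚ./ 1)))
theorem6 R ι ι-hom b m _ = D-reflected m , D-vanishes m , D-large m
  where
  open Specialisation R ι ι-hom b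
  open Moments R b using (D-vanishes)
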